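{- Let $F$ be a geometric graph and let $F_2$ be the geometric graph consisting of two completely disjoint copies of $F$. Then there is a constant $C$ (independent of $n$) such that for all $n\ge 2$, $$ex(F_2,n)\le C\Big(\big(ex_L(F,2n)+n\big)\log n+ex(F,n)\Big).$$
   Context: A geometric graph is a graph drawn in the plane with vertices as points and edges as straight-line segments; edges do not pass through vertices other than their endpoints. Two edges cross if their relative interiors share a point; two edges are disjoint if they share no point. A geometric graph $G$ contains a geometric graph $F$ as a geometric subgraph if $G$ has a subgraph $F'$ isomorphic to $F$ such that two edges of $F'$ cross if and only if the corresponding edges of $F$ cross. $ex(F,n)$ is the maximum number of edges of an $n$-vertex geometric graph not containing $F$ as a geometric subgraph; $ex_L(F,n)$ is the same maximum taken only over $n$-vertex geometric graphs all of whose edges are intersected by a single line. $F_2$ denotes a geometric graph formed by two vertex-disjoint copies of $F$ such that every edge of one copy is disjoint from every edge of the other copy.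
   Formalization: The geometric graphs F, F_2 and all graphs over which ex and ex_L are taken have vertices with rational coordinates, and the line meeting all edges has rational coefficients, in place of the real plane. -}

module Defs where

open import Data.Nat as ℕ using (ℕ; _<ᵇ_)
open import Data.Fin using (Fin; toℕ)
open import Data.Bool using (Bool; true; false; _∧_)
open import Data.List using (List; length; filterᵇ; cartesianProduct; allFin)
open import Data.Product using (_×_; _,_; Σ; ∃; ∃-syntax)
open import Data.Sum using (_⊎_)
open import Data.Rational using (ℚ; 0ℚ; 1ℚ; _+_; _*_; _-_; _<_; _≤_)
open import Relation.Binary.PropositionalEquality using (_≡_; _≢_)
open import Relation.Nullary using (¬_)

Point : Set
Point = ℚ × ℚ

lerp : Point → Point → ℚ → Point
lerp (x₁ , y₁) (x₂ , y₂) s = ((1ℚ - s) * x₁ + s * x₂ , (1ℚ - s) * y₁ + s * y₂)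

OnOpenSeg : Point → Point → Point → Set
OnOpenSeg p a b = ∃[ s ] (0ℚ < s × s < 1ℚ × lerp a b s ≡ p)

OnClosedSeg : Point → Point → Point → Set
OnClosedSeg p a b = ∃[ s ] (0ℚ ≤ s × s ≤ 1ℚ × lerp a b s ≡ p)

record GeomGraph : Set where
  field
    size       : ℕ
    pos        : Fin size → Point
    pos-inj    : ∀ i j → pos i ≡ pos j → i ≡ j
    adj        : Fin size → Fin size → Bool
    adj-sym    : ∀ i j → adj i j ≡ adj j i
    adj-irrefl : ∀ i → adj i i ≡ false
    no-pass    : ∀ i j v → adj i j ≡ true → ¬ OnOpenSeg (pos v) (pos i) (pos j)

open GeomGraph public

Edge : (G : GeomGraph) → Fin (size G) → Fin (size G) → Set
Edge G i j = adj G i j ≡ true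

Cross : (G : GeomGraph) → (i j k l : Fin (size G)) → Set
Cross G i j k l = ∃[ p ] (OnOpenSeg p (pos G i) (pos G j) × OnOpenSeg p (pos G k) (pos G l))

SegDisjoint : (G : GeomGraph) → (i j k l : Fin (size G)) → Set
SegDisjoint G i j k l = ¬ (∃[ p ] (OnClosedSeg p (pos G i) (pos G j) × OnClosedSeg p (pos G k) (pos G l)))

edgeCount : GeomGraph → ℕ
edgeCount G = length (filterᵇ (λ { (i , j) → (toℕ i <ᵇ toℕ j) ∧ adj G i j })
                              (cartesianProduct (allFin (size G)) (allFin (size G))))

GeomEmbedding : (F G : GeomGraph) → (Fin (size F) → Fin (size G)) → Set
GeomEmbedding F G φ =
  (∀ i j → φ i ≡ φ j → i ≡ j) ×
  (∀ i j → Edge F i j → Edge G (φ i) (φ j)) ×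
  (∀ i j k l → Edge F i j → Edge F k l →
     (Cross F i j k l → Cross G (φ i) (φ j) (φ k) (φ l)) ×
     (Cross G (φ i) (φ j) (φ k) (φ l) → Cross F i j k l))

Contains : GeomGraph → GeomGraph → Set
Contains G F = ∃[ φ ] GeomEmbedding F G φ

IsTwoDisjointCopies : GeomGraph → GeomGraph → Set
IsTwoDisjointCopies F H =
  Σ (Fin (size F) → Fin (size H)) λ φ₁ →
  Σ (Fin (size F) → Fin (size H)) λ φ₂ →
    GeomEmbedding F H φ₁ × GeomEmbedding F H φ₂ ×
    (∀ i j → φ₁ i ≢ φ₂ j) ×
    (∀ v → ∃[ i ] (φ₁ i ≡ v ⊎ φ₂ i ≡ v)) ×
    (∀ u v → Edge H u v →
       (∃[ i ] ∃[ j ] (Edge F i j × φ₁ i ≡ u × φ₁ j ≡ v)) ⊎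
       (∃[ i ] ∃[ j ] (Edge F i j × φ₂ i ≡ u × φ₂ j ≡ v))) ×
    (∀ i j k l → Edge F i j → Edge F k l → SegDisjoint H (φ₁ i) (φ₁ j) (φ₂ k) (φ₂ l))

LineStabbed : GeomGraph → Set
LineStabbed G = ∃[ a ] ∃[ b ] ∃[ c ] (¬ (a ≡ 0ℚ × b ≡ 0ℚ) ×
  (∀ i j → Edge G i j → ∃[ p ] (OnClosedSeg p (pos G i) (pos G j) ×
     a * Data.Product.proj₁ p + b * Data.Product.proj₂ p ≡ c)))

IsEx : GeomGraph → ℕ → ℕ → Set
IsEx F n e =
  (∃[ G ] (size G ≡ n × ¬ Contains G F × edgeCount G ≡ e)) ×
  (∀ G → size G ≡ n → ¬ Contains G F → edgeCount G ℕ.≤ e)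

IsExL : GeomGraph → ℕ → ℕ → Set
IsExL F n e =
  (∃[ G ] (size G ≡ n × LineStabbed G × ¬ Contains G F × edgeCount G ≡ e)) ×
  (∀ G → size G ≡ n → LineStabbed G → ¬ Contains G F → edgeCount G ℕ.≤ e)

{-# OPTIONS --safe #-}
-- Cut G by a (slightly sheared) vertical line at the first position where the part to its left contains F. Both sides
-- are then F-free up to one vertex, because F on both sides would give F₂, and what remains is stabbed by a line ℓ.
-- Let ℓ = {x = 0}, and fix a direction of slope θ. Cutting in the same way along this direction leaves, besides
-- two F-free graphs stabbed by ℓ and a star, only edges that cross both lines; those steeper than θ join the
-- lower left to the upper right quadrant, the others join the upper left to the lower right one. So the two kinds
-- span disjoint vertex sets, and bisecting the slopes recursively produces O(log n) levels.
-- The F-free graphs occurring in one level have disjoint vertex sets but overlap in the plane. They can be redrawn as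
-- one F-free graph stabbed by ℓ: either pull them apart vertically, or shear them so that any two edges of distinct
-- graphs cross. If the crossing relation on the edges of F is connected, F cannot be spread over several graphs in
-- the first drawing; otherwise its complement is connected, and F cannot be spread in the second.
module Submission where

open import Defs

-- A level has many F-free pieces, and they must be charged together: a union of F-free pieces may
-- contain F as soon as F can be spread over several of them. This obstacle is the reason for
-- redrawing. Slopes enter only through their rank among the n² ordered pairs of vertices, so 2(1 +
-- ⌊log₂ n⌋) halvings isolate a single slope. Two edges of one slope that leave a vertex to the
-- right would overlap, so only linearly many edges are left then. Isolated vertices of F are a
-- nuisance: copies found on the two sides of a cut may compete for places for them. Containment is
-- therefore weakened so as to ignore them, and they are put back once, in a graph that is known to
-- have enough vertices. Containment and crossing are never decided. Case distinctions are made
-- under a double negation, which is shed at the end because the goal is an inequality between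
-- naturals.

module PlaneGeometry where

  open import Data.Empty using (⊥-elim)
  open import Data.Fin using (Fin; zero; suc)
  open import Data.Nat as ℕ using (ℕ; zero; suc)
  import Data.Nat.Properties as ℕ
  open import Data.Product using (_×_; _,_; ∃-syntax; proj₁; proj₂)
  open import Data.Rational using (ℚ; 0ℚ; 1ℚ; _+_; _*_; _-_; -_; _<_; _≤_; _⊔_; positive; nonNegative; ≢-nonZero; 1/_)
  open import Data.Rational.Properties
  open import Data.Rational.Solver using (module +-*-Solver)
  open import Data.Sum using (_⊎_; inj₁; inj₂)
  open import Relation.Binary.Definitions using (tri<; tri≈; tri>)
  open import Relation.Binary.PropositionalEquality
  open import Relation.Nullary using (¬_; yes; no; contradiction)

  open +-*-Solver

  -- Rational arithmetic, affine functionals and crossing segments.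

  0<q-p : ∀ {p q} → p < q → 0ℚ < q - p
  0<q-p {p} {q} p<q = subst (_< q - p) (+-inverseʳ p) (+-monoˡ-< (- p) p<q)

  0≤q-p : ∀ {p q} → p ≤ q → 0ℚ ≤ q - p
  0≤q-p {p} {q} p≤q = subst (_≤ q - p) (+-inverseʳ p) (+-monoˡ-≤ (- p) p≤q)

  q-p+p : ∀ p q → (q - p) + p ≡ q
  q-p+p = solve 2 (λ p q → (q :- p) :+ p := q) refl

  0<q-p⇒p<q : ∀ {p q} → 0ℚ < q - p → p < q
  0<q-p⇒p<q {p} {q} lt = subst₂ _<_ (+-identityˡ p) (q-p+p p q) (+-monoˡ-< p lt)

  0≤q-p⇒p≤q : ∀ {p q} → 0ℚ ≤ q - p → p ≤ q
  0≤q-p⇒p≤q {p} {q} le = subst₂ _≤_ (+-identityˡ p) (q-p+p p q) (+-monoˡ-≤ p le)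

  *-pos : ∀ {p q} → 0ℚ < p → 0ℚ < q → 0ℚ < p * q
  *-pos {p} {q} 0<p 0<q = positive⁻¹ (p * q) {{pos*pos⇒pos p {{positive 0<p}} q {{positive 0<q}}}}

  *-nonNeg : ∀ {p q} → 0ℚ ≤ p → 0ℚ ≤ q → 0ℚ ≤ p * q
  *-nonNeg {p} {q} 0≤p 0≤q = nonNegative⁻¹ (p * q) {{nonNeg*nonNeg⇒nonNeg p {{nonNegative 0≤p}} q {{nonNegative 0≤q}}}}

  +-nonNeg : ∀ {p q} → 0ℚ ≤ p → 0ℚ ≤ q → 0ℚ ≤ p + q
  +-nonNeg = +-mono-≤

  p-q≡0⇒p≡q : ∀ {p q} → p - q ≡ 0ℚ → p ≡ q
  p-q≡0⇒p≡q {p} {q} eq = trans (sym (q-p+p q p)) (trans (cong (_+ q) eq) (+-identityˡ q))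

  -- The reciprocal, with the junk value 1/0 = 0.
  inv : ℚ → ℚ
  inv p with p ≟ 0ℚ
  ... | yes _ = 0ℚ
  ... | no p≢0 = (1/ p) {{≢-nonZero p≢0}}

  *-inv : ∀ {p} → p ≢ 0ℚ → p * inv p ≡ 1ℚ
  *-inv {p} p≢0 with p ≟ 0ℚ
  ... | yes p≡0 = contradiction p≡0 p≢0
  ... | no p≢0′ = *-inverseʳ p {{≢-nonZero p≢0′}}

  inv-pos : ∀ {p} → 0ℚ < p → 0ℚ < inv p
  inv-pos {p} 0<p with p ≟ 0ℚ
  ... | yes p≡0 = contradiction (sym p≡0) (<⇒≢ 0<p)
  ... | no p≢0 = positive⁻¹ _ {{1/pos⇒pos p {{positive 0<p}}}}

  mix : ℚ → ℚ → ℚ → ℚ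
  mix p q s = (1ℚ - s) * p + s * q

  mix-≤ : ∀ {p q s m} → 0ℚ ≤ s → s ≤ 1ℚ → p ≤ m → q ≤ m → mix p q s ≤ m
  mix-≤ {p} {q} {s} {m} 0≤s s≤1 p≤m q≤m = 0≤q-p⇒p≤q (subst (0ℚ ≤_)
    (solve 4 (λ p q s m → (con 1ℚ :- s) :* (m :- p) :+ s :* (m :- q) :=
                          m :- ((con 1ℚ :- s) :* p :+ s :* q)) refl p q s m)
    (+-nonNeg (*-nonNeg (0≤q-p s≤1) (0≤q-p p≤m)) (*-nonNeg 0≤s (0≤q-p q≤m))))

  mix-≥ : ∀ {p q s m} → 0ℚ ≤ s → s ≤ 1ℚ → m ≤ p → m ≤ q → m ≤ mix p q s
  mix-≥ {p} {q} {s} {m} 0≤s s≤1 m≤p m≤q = 0≤q-p⇒p≤q (subst (0ℚ ≤_)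
    (solve 4 (λ p q s m → (con 1ℚ :- s) :* (p :- m) :+ s :* (q :- m) :=
                          ((con 1ℚ :- s) :* p :+ s :* q) :- m) refl p q s m)
    (+-nonNeg (*-nonNeg (0≤q-p s≤1) (0≤q-p m≤p)) (*-nonNeg 0≤s (0≤q-p m≤q))))

  mix-< : ∀ {p q s m} → 0ℚ ≤ s → s ≤ 1ℚ → p < m → q < m → mix p q s < m
  mix-< {p} {q} 0≤s s≤1 p<m q<m with ≤-total p q
  ... | inj₁ p≤q = ≤-<-trans (mix-≤ 0≤s s≤1 p≤q ≤-refl) q<m
  ... | inj₂ q≤p = ≤-<-trans (mix-≤ 0≤s s≤1 ≤-refl q≤p) p<m

  mix-> : ∀ {p q s m} → 0ℚ ≤ s → s ≤ 1ℚ → m < p → m < q → m < mix p q s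
  mix-> {p} {q} 0≤s s≤1 m<p m<q with ≤-total p q
  ... | inj₁ p≤q = <-≤-trans m<p (mix-≥ 0≤s s≤1 ≤-refl p≤q)
  ... | inj₂ q≤p = <-≤-trans m<q (mix-≥ 0≤s s≤1 q≤p ≤-refl)

  mix-solve : ∀ {p q r} → p ≤ q → q < r → ∃[ s ] (0ℚ ≤ s × s < 1ℚ × mix p r s ≡ q)
  mix-solve {p} {q} {r} p≤q q<r = s , 0≤s , s<1 , eq
    where
    i = inv (r - p)
    0<r-p = 0<q-p (≤-<-trans p≤q q<r)
    r-p≢0 : r - p ≢ 0ℚ
    r-p≢0 e = <⇒≢ 0<r-p (sym e)
    s = (q - p) * i
    0≤s = *-nonNeg (0≤q-p p≤q) (<⇒≤ (inv-pos 0<r-p))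
    [r-p]i≡1 = *-inv r-p≢0
    1-s : (r - q) * i ≡ 1ℚ - s
    1-s = trans (solve 4 (λ p q r i → (r :- q) :* i := (r :- p) :* i :- (q :- p) :* i) refl p q r i)
                (cong (_- s) [r-p]i≡1)
    s<1 = 0<q-p⇒p<q (subst (0ℚ <_) 1-s (*-pos (0<q-p q<r) (inv-pos 0<r-p)))
    eq : mix p r s ≡ q
    eq = begin
      (1ℚ - s) * p + s * r        ≡⟨ solve 4 (λ p q r i → (con 1ℚ :- (q :- p) :* i) :* p :+ (q :- p) :* i :* r
                                         := p :+ (q :- p) :* ((r :- p) :* i)) refl p q r i ⟩
      p + (q - p) * ((r - p) * i) ≡⟨ cong (λ z → p + (q - p) * z) [r-p]i≡1 ⟩
      p + (q - p) * 1ℚ            ≡⟨ solve 2 (λ p q → p :+ (q :- p) :* con 1ℚ := q) refl p q ⟩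
      q                           ∎
      where open ≡-Reasoning

  mix-0 : ∀ p q → mix p q 0ℚ ≡ p
  mix-0 p q = trans (cong₂ _+_ (*-identityˡ p) (*-zeroˡ q)) (+-identityʳ p)

  mix-solve-pos : ∀ {p q r} → p < q → q < r → ∃[ s ] (0ℚ < s × s < 1ℚ × mix p r s ≡ q)
  mix-solve-pos {p} {q} {r} p<q q<r =
    let s , 0≤s , s<1 , eq = mix-solve (<⇒≤ p<q) q<r
        s≢0 : s ≢ 0ℚ
        s≢0 s≡0 = <⇒≢ p<q (trans (sym (mix-0 p r)) (trans (cong (mix p r) (sym s≡0)) eq))
    in s , ≤∧≢⇒< 0≤s (λ 0≡s → s≢0 (sym 0≡s)) , s<1 , eq
    where
    ≤∧≢⇒< : ∀ {p q} → p ≤ q → p ≢ q → p < q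
    ≤∧≢⇒< p≤q p≢q = ≰⇒> λ q≤p → p≢q (≤-antisym p≤q q≤p)

  record IsAffine (g : Point → ℚ) : Set where
    constructor affine
    field on-lerp : ∀ a b s → g (lerp a b s) ≡ mix (g a) (g b) s
  open IsAffine public

  proj₁-affine : IsAffine proj₁
  proj₁-affine = affine λ _ _ _ → refl

  proj₂-affine : IsAffine proj₂
  proj₂-affine = affine λ _ _ _ → refl

  +-affine : ∀ {g h} → IsAffine g → IsAffine h → IsAffine (λ p → g p + h p)
  +-affine {g} {h} ga ha = affine λ a b s → trans (cong₂ _+_ (on-lerp ga a b s) (on-lerp ha a b s))
    (solve 5 (λ ga gb ha hb s → (con 1ℚ :- s) :* ga :+ s :* gb :+ ((con 1ℚ :- s) :* ha :+ s :* hb) :=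
        (con 1ℚ :- s) :* (ga :+ ha) :+ s :* (gb :+ hb)) refl (g a) (g b) (h a) (h b) s)

  *-affine : ∀ c {g} → IsAffine g → IsAffine (λ p → c * g p)
  *-affine c {g} ga = affine λ a b s → trans (cong (c *_) (on-lerp ga a b s))
    (solve 4 (λ c ga gb s → c :* ((con 1ℚ :- s) :* ga :+ s :* gb) :=
        (con 1ℚ :- s) :* (c :* ga) :+ s :* (c :* gb)) refl c (g a) (g b) s)

  const-affine : ∀ c → IsAffine (λ _ → c)
  const-affine c = affine λ a b s → solve 2 (λ c s → c := (con 1ℚ :- s) :* c :+ s :* c) refl c s

  CrossPt : (a b c d : Point) → Set
  CrossPt a b c d = ∃[ p ] (OnOpenSeg p a b × OnOpenSeg p c d)

  -- At a common point the value of `g` would be an average of `g a` and `g b` and also an average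
  -- of `g c` and `g d`; every average of the first kind is smaller than every one of the second.
  separated⇒¬cross : ∀ {g} → IsAffine g → ∀ {a b c d} →
    g a < g c → g a < g d → g b < g c → g b < g d → ¬ CrossPt a b c d
  separated⇒¬cross {g} ga {a} {b} {c} {d} a<c a<d b<c b<d (p , (s , 0<s , s<1 , refl) , (t , 0<t , t<1 , eq)) =
    <-irrefl (sym g≡) (mix-> (<⇒≤ 0<t) (<⇒≤ t<1) (mix-< (<⇒≤ 0<s) (<⇒≤ s<1) a<c b<c) (mix-< (<⇒≤ 0<s) (<⇒≤ s<1) a<d b<d))
    where
    g≡ : mix (g c) (g d) t ≡ mix (g a) (g b) s
    g≡ = trans (sym (on-lerp ga c d t)) (trans (cong g eq) (on-lerp ga a b s))

  lerp-swap : ∀ a b s → lerp a b (1ℚ - s) ≡ lerp b a s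
  lerp-swap (a₁ , a₂) (b₁ , b₂) s = cong₂ _,_ (swap a₁ b₁) (swap a₂ b₂)
    where
    swap : ∀ p q → mix p q (1ℚ - s) ≡ mix q p s
    swap p q = solve 3 (λ p q s → (con 1ℚ :- (con 1ℚ :- s)) :* p :+ (con 1ℚ :- s) :* q :=
      (con 1ℚ :- s) :* q :+ s :* p) refl p q s

  1-s<1 : ∀ {s} → 0ℚ < s → 1ℚ - s < 1ℚ
  1-s<1 {s} 0<s = 0<q-p⇒p<q (subst (0ℚ <_) (solve 1 (λ s → s := con 1ℚ :- (con 1ℚ :- s)) refl s) 0<s)

  open-sym : ∀ {p a b} → OnOpenSeg p a b → OnOpenSeg p b a
  open-sym {a = a} {b} (s , 0<s , s<1 , eq) = 1ℚ - s , 0<q-p s<1 , 1-s<1 0<s , trans (lerp-swap b a s) eq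

  cross-swapˡ : ∀ {a b c d} → CrossPt a b c d → CrossPt b a c d
  cross-swapˡ (p , o , o′) = p , open-sym o , o′

  cross-swapʳ : ∀ {a b c d} → CrossPt a b c d → CrossPt a b d c
  cross-swapʳ (p , o , o′) = p , o , open-sym o′

  cross-sym : ∀ {a b c d} → CrossPt a b c d → CrossPt c d a b
  cross-sym (p , o , o′) = p , o′ , o

  IsAffineMap : (Point → Point) → Set
  IsAffineMap M = ∀ a b s → M (lerp a b s) ≡ lerp (M a) (M b) s

  ⟨_,_⟩-affineMap : ∀ {g h} → IsAffine g → IsAffine h → IsAffineMap (λ p → g p , h p)
  ⟨ ga , ha ⟩-affineMap a b s = cong₂ _,_ (on-lerp ga a b s) (on-lerp ha a b s)

  module _ {M : Point → Point} (aff : IsAffineMap M) where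

    open-map : ∀ {p a b} → OnOpenSeg p a b → OnOpenSeg (M p) (M a) (M b)
    open-map {a = a} {b} (s , 0<s , s<1 , refl) = s , 0<s , s<1 , sym (aff a b s)

    cross-map : ∀ {a b c d} → CrossPt a b c d → CrossPt (M a) (M b) (M c) (M d)
    cross-map (p , o , o′) = M p , open-map o , open-map o′

    module _ (inj : ∀ p q → M p ≡ M q → p ≡ q) where

      open-unmap : ∀ {p a b} → OnOpenSeg (M p) (M a) (M b) → OnOpenSeg p a b
      open-unmap {a = a} {b} (s , 0<s , s<1 , eq) = s , 0<s , s<1 , inj _ _ (trans (aff a b s) eq)

      cross-unmap : ∀ {a b c d} → CrossPt (M a) (M b) (M c) (M d) → CrossPt a b c d
      cross-unmap {a} {b} (p , (s , 0<s , s<1 , refl) , (t , 0<t , t<1 , eq)) =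
        lerp a b s , (s , 0<s , s<1 , refl) , (t , 0<t , t<1 , inj _ _ (trans (aff _ _ t) (trans eq (sym (aff a b s)))))

  bounded : ∀ {n} (f : Fin n → ℚ) → ∃[ B ] (∀ i → f i < B)
  bounded {zero} f = 0ℚ , λ ()
  bounded {suc n} f with bounded (λ i → f (suc i))
  ... | B , f<B = f zero ⊔ B + 1ℚ , λ
    { zero → ≤-<-trans (p≤p⊔q (f zero) B) (m<m+1 _)
    ; (suc i) → <-trans (f<B i) (≤-<-trans (p≤q⊔p (f zero) B) (m<m+1 _)) }
    where
    m<m+1 : ∀ m → m < m + 1ℚ
    m<m+1 m = subst (_< m + 1ℚ) (+-identityʳ m) (+-monoʳ-< m (positive⁻¹ 1ℚ))

  mix-solveʳ : ∀ {p q r} → p < q → q ≤ r → ∃[ s ] (0ℚ < s × s ≤ 1ℚ × mix p r s ≡ q)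
  mix-solveʳ {p} {q} {r} p<q q≤r =
    let s , 0≤s , s<1 , eq = mix-solve (neg-antimono-≤ q≤r) (neg-antimono-< p<q)
    in 1ℚ - s , 0<q-p s<1 , 0≤q-p⇒p≤q (subst (0ℚ ≤_) (solve 1 (λ s → s := con 1ℚ :- (con 1ℚ :- s)) refl s) 0≤s) ,
       trans (solve 3 (λ p r s → (con 1ℚ :- (con 1ℚ :- s)) :* p :+ (con 1ℚ :- s) :* r
                         := :- ((con 1ℚ :- s) :* (:- r) :+ s :* (:- p))) refl p r s)
         (trans (cong -_ eq) (solve 1 (λ q → :- (:- q) := q) refl q))

  mix-pos : ∀ {p q s} → 0ℚ < s → s ≤ 1ℚ → 0ℚ ≤ p → 0ℚ < q → 0ℚ < mix p q s
  mix-pos {p} {q} {s} 0<s s≤1 0≤p 0<q =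
    +-mono-≤-< (*-nonNeg (0≤q-p s≤1) 0≤p) (*-pos 0<s 0<q)

  mix-<1 : ∀ {p q s} → 0ℚ ≤ s → s < 1ℚ → p < 1ℚ → q ≤ 1ℚ → mix p q s < 1ℚ
  mix-<1 {p} {q} {s} 0≤s s<1 p<1 q≤1 = 0<q-p⇒p<q (subst (0ℚ <_)
    (solve 3 (λ p q s → (con 1ℚ :- s) :* (con 1ℚ :- p) :+ s :* (con 1ℚ :- q) :=
                        con 1ℚ :- ((con 1ℚ :- s) :* p :+ s :* q)) refl p q s)
    (+-mono-<-≤ (*-pos (0<q-p s<1) (0<q-p p<1)) (*-nonNeg 0≤s (0≤q-p q≤1))))

  mix-mix : ∀ p q s t r → mix p q (mix s t r) ≡ mix (mix p q s) (mix p q t) r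
  mix-mix = solve 5 (λ p q s t r →
    (con 1ℚ :- ((con 1ℚ :- r) :* s :+ r :* t)) :* p :+ ((con 1ℚ :- r) :* s :+ r :* t) :* q :=
    (con 1ℚ :- r) :* ((con 1ℚ :- s) :* p :+ s :* q) :+ r :* ((con 1ℚ :- t) :* p :+ t :* q)) refl

  mix-1 : ∀ p q → mix p q 1ℚ ≡ q
  mix-1 p q = trans (cong₂ _+_ (*-zeroˡ p) (*-identityˡ q)) (+-identityˡ q)

  0≤1 : 0ℚ ≤ 1ℚ
  0≤1 = nonNegative⁻¹ 1ℚ

  0<1 : 0ℚ < 1ℚ
  0<1 = positive⁻¹ 1ℚ

  -- Heights are compared only at abscissae where one of the segments begins or ends, because
  -- `place-cross` controls its displacement `L` only at vertices. Both segments pass over x = 0, so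
  -- the later beginning comes before the earlier end.
  module _ {x₁ x₂ z₁ z₂ u₁ u₂ w₁ w₂ : ℚ}
    (x₁<0 : x₁ < 0ℚ) (0<x₂ : 0ℚ < x₂) (u₁<0 : u₁ < 0ℚ) (0<u₂ : 0ℚ < u₂)
    (below-left : ∀ s t → 0ℚ ≤ s → s ≤ 1ℚ → 0ℚ ≤ t → t ≤ 1ℚ → mix x₁ x₂ s ≡ mix u₁ u₂ t →
       mix x₁ x₂ s ≡ x₁ ⊎ mix x₁ x₂ s ≡ u₁ → mix z₁ z₂ s < mix w₁ w₂ t)
    (above-right : ∀ s t → 0ℚ ≤ s → s ≤ 1ℚ → 0ℚ ≤ t → t ≤ 1ℚ → mix x₁ x₂ s ≡ mix u₁ u₂ t →
       mix x₁ x₂ s ≡ x₂ ⊎ mix x₁ x₂ s ≡ u₂ → mix w₁ w₂ t < mix z₁ z₂ s)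
    where

    private
      -- The parameters are half-open, below 1 here and above 0 in `right`: a proper convex
      -- combination of one of each then lies strictly between 0 and 1, as open segments demand.
      left : ∃[ s ] ∃[ t ] (0ℚ ≤ s × s < 1ℚ × 0ℚ ≤ t × t < 1ℚ ×
               mix x₁ x₂ s ≡ mix u₁ u₂ t × mix z₁ z₂ s < mix w₁ w₂ t)
      left with ≤-total x₁ u₁
      ... | inj₁ x≤u =
        let s , 0≤s , s<1 , eq = mix-solve x≤u (<-trans u₁<0 0<x₂)
            e = trans eq (sym (mix-0 u₁ u₂))
        in s , 0ℚ , 0≤s , s<1 , ≤-refl , 0<1 , e , below-left s 0ℚ 0≤s (<⇒≤ s<1) ≤-refl 0≤1 e (inj₂ eq)
      ... | inj₂ u≤x =
        let t , 0≤t , t<1 , eq = mix-solve u≤x (<-trans x₁<0 0<u₂)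
            e = trans (mix-0 x₁ x₂) (sym eq)
        in 0ℚ , t , ≤-refl , 0<1 , 0≤t , t<1 , e , below-left 0ℚ t ≤-refl 0≤1 0≤t (<⇒≤ t<1) e (inj₁ (mix-0 x₁ x₂))

      right : ∃[ s ] ∃[ t ] (0ℚ < s × s ≤ 1ℚ × 0ℚ < t × t ≤ 1ℚ ×
                mix x₁ x₂ s ≡ mix u₁ u₂ t × mix w₁ w₂ t < mix z₁ z₂ s)
      right with ≤-total x₂ u₂
      ... | inj₁ x≤u =
        let t , 0<t , t≤1 , eq = mix-solveʳ (<-trans u₁<0 0<x₂) x≤u
            e = trans (mix-1 x₁ x₂) (sym eq)
        in 1ℚ , t , 0<1 , ≤-refl , 0<t , t≤1 , e , above-right 1ℚ t 0≤1 ≤-refl (<⇒≤ 0<t) t≤1 e (inj₁ (mix-1 x₁ x₂))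
      ... | inj₂ u≤x =
        let s , 0<s , s≤1 , eq = mix-solveʳ (<-trans x₁<0 0<u₂) u≤x
            e = trans eq (sym (mix-1 u₁ u₂))
        in s , 1ℚ , 0<s , s≤1 , 0<1 , ≤-refl , e , above-right s 1ℚ (<⇒≤ 0<s) s≤1 0≤1 ≤-refl e (inj₂ eq)

    -- Between the rightmost left endpoint and the leftmost right endpoint the
    -- height difference of the two segments changes sign.
    alternating⇒cross : CrossPt (x₁ , z₁) (x₂ , z₂) (u₁ , w₁) (u₂ , w₂)
    alternating⇒cross =
      let s , t , 0≤s , s<1 , 0≤t , t<1 , x≡u , z<w = left
          s′ , t′ , 0<s′ , s′≤1 , 0<t′ , t′≤1 , x≡u′ , w<z′ = right
          r , 0<r , r<1 , eq = mix-solve-pos (neg-antimono-< (0<q-p z<w)) (0<q-p w<z′)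
      in lerp (x₁ , z₁) (x₂ , z₂) (mix s s′ r) ,
         (mix s s′ r , mix-pos 0<r (<⇒≤ r<1) 0≤s 0<s′ , mix-<1 (<⇒≤ 0<r) r<1 s<1 s′≤1 , refl) ,
         (mix t t′ r , mix-pos 0<r (<⇒≤ r<1) 0≤t 0<t′ , mix-<1 (<⇒≤ 0<r) r<1 t<1 t′≤1 ,
          cong₂ _,_ (same-x s t s′ t′ r x≡u x≡u′) (same-z s t s′ t′ r eq))
      where
      same-x : ∀ s t s′ t′ r → mix x₁ x₂ s ≡ mix u₁ u₂ t → mix x₁ x₂ s′ ≡ mix u₁ u₂ t′ →
        mix u₁ u₂ (mix t t′ r) ≡ mix x₁ x₂ (mix s s′ r)
      same-x s t s′ t′ r e e′ = trans (mix-mix u₁ u₂ t t′ r)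
        (trans (cong₂ (λ a b → mix a b r) (sym e) (sym e′)) (sym (mix-mix x₁ x₂ s s′ r)))
      diff : ∀ a b c d r → mix a b r - mix c d r ≡ mix (- (c - a)) (b - d) r
      diff = solve 5 (λ a b c d r → ((con 1ℚ :- r) :* a :+ r :* b) :- ((con 1ℚ :- r) :* c :+ r :* d) :=
        (con 1ℚ :- r) :* (:- (c :- a)) :+ r :* (b :- d)) refl
      same-z : ∀ s t s′ t′ r →
        mix (- (mix w₁ w₂ t - mix z₁ z₂ s)) (mix z₁ z₂ s′ - mix w₁ w₂ t′) r ≡ 0ℚ →
        mix w₁ w₂ (mix t t′ r) ≡ mix z₁ z₂ (mix s s′ r)
      same-z s t s′ t′ r eq = sym (p-q≡0⇒p≡q {mix z₁ z₂ (mix s s′ r)} {mix w₁ w₂ (mix t t′ r)}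
        (trans (cong₂ _-_ (mix-mix z₁ z₂ s s′ r) (mix-mix w₁ w₂ t t′ r))
          (trans (diff (mix z₁ z₂ s) (mix z₁ z₂ s′) (mix w₁ w₂ t) (mix w₁ w₂ t′) r) eq)))

  -- Displacing copies of a drawing vertically.

  ι : ℕ → ℚ
  ι zero = 0ℚ
  ι (suc n) = 1ℚ + ι n

  ι-nonNeg : ∀ n → 0ℚ ≤ ι n
  ι-nonNeg zero = ≤-refl
  ι-nonNeg (suc n) = +-nonNeg 0≤1 (ι-nonNeg n)

  ι-gap : ∀ {c d} → c ℕ.< d → 0ℚ ≤ ι d - ι c - 1ℚ
  ι-gap {zero} {suc d} _ = subst (0ℚ ≤_)
    (solve 1 (λ x → x := con 1ℚ :+ x :- con 0ℚ :- con 1ℚ) refl (ι d)) (ι-nonNeg d)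
  ι-gap {suc c} {suc d} (ℕ.s≤s c<d) = subst (0ℚ ≤_)
    (solve 2 (λ x y → x :- y :- con 1ℚ := con 1ℚ :+ x :- (con 1ℚ :+ y) :- con 1ℚ) refl (ι d) (ι c)) (ι-gap c<d)

  Within : ℚ → ℚ → Set
  Within Y p = - Y < p × p < Y

  -- A displacement by at least the width of the band (-Y, Y) carries the band off itself. Both
  -- signs occur because a shear moves the two sides of the axis in opposite directions.
  Far : ℚ → ℚ → Set
  Far Y l = l ≤ - (Y + Y) ⊎ Y + Y ≤ l

  mix-within : ∀ {Y p q s} → 0ℚ ≤ s → s ≤ 1ℚ → Within Y p → Within Y q → Within Y (mix p q s)
  mix-within 0≤s s≤1 (a , b) (c , d) = mix-> 0≤s s≤1 a c , mix-< 0≤s s≤1 b d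

  within⇒0<Y : ∀ {Y p} → Within Y p → 0ℚ < Y + Y
  within⇒0<Y {Y} (-Y<p , p<Y) = subst (0ℚ <_) (solve 1 (λ y → y :- :- y := y :+ y) refl Y) (0<q-p (<-trans -Y<p p<Y))

  -- The difference of the two sides is (q + Y) + (Y - p), which is positive, plus (l - 2Y) + (d - c
  -- - 1) l, which is not negative.
  offset-< : ∀ {Y p q l c d} → Within Y p → Within Y q → c ℕ.< d → Y + Y ≤ l → p + ι c * l < q + ι d * l
  offset-< {Y} {p} {q} {l} {c} {d} wp@(_ , p<Y) (-Y<q , _) c<d 2Y≤l = 0<q-p⇒p<q (subst (0ℚ <_)
    (solve 6 (λ y p q l c d → (q :- :- y) :+ (y :- p) :+ ((l :- (y :+ y)) :+ (d :- c :- con 1ℚ) :* l) :=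
        q :+ d :* l :- (p :+ c :* l)) refl Y p q l (ι c) (ι d))
    (+-mono-<-≤ (+-mono-< (0<q-p -Y<q) (0<q-p p<Y))
      (+-nonNeg (0≤q-p 2Y≤l) (*-nonNeg (ι-gap c<d) (≤-trans (<⇒≤ (within⇒0<Y wp)) 2Y≤l)))))

  offset-> : ∀ {Y p q l c d} → Within Y p → Within Y q → c ℕ.< d → l ≤ - (Y + Y) → q + ι d * l < p + ι c * l
  offset-> {Y} {p} {q} {l} {c} {d} wp@(-Y<p , _) (_ , q<Y) c<d l≤ = 0<q-p⇒p<q (subst (0ℚ <_)
    (solve 6 (λ y p q l c d → (p :- :- y) :+ (y :- q) :+ ((:- (y :+ y) :- l) :+ (d :- c :- con 1ℚ) :* (con 0ℚ :- l)) :=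
        p :+ c :* l :- (q :+ d :* l)) refl Y p q l (ι c) (ι d))
    (+-mono-<-≤ (+-mono-< (0<q-p -Y<p) (0<q-p q<Y))
      (+-nonNeg (0≤q-p l≤) (*-nonNeg (ι-gap c<d) (0≤q-p (≤-trans l≤ (neg-antimono-≤ (<⇒≤ (within⇒0<Y wp)))))))))

  offset-≢ : ∀ {Y p q l c d} → Within Y p → Within Y q → Far Y l → c ≢ d → p + ι c * l ≢ q + ι d * l
  offset-≢ {c = c} {d} wp wq far c≢d eq with ℕ.<-cmp c d | far
  ... | tri≈ _ c≡d _ | _ = c≢d c≡d
  ... | tri< c<d _ _ | inj₁ l≤ = <⇒≢ (offset-> wp wq c<d l≤) (sym eq)
  ... | tri< c<d _ _ | inj₂ ≤l = <⇒≢ (offset-< wp wq c<d ≤l) eq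
  ... | tri> _ _ d<c | inj₁ l≤ = <⇒≢ (offset-> wq wp d<c l≤) eq
  ... | tri> _ _ d<c | inj₂ ≤l = <⇒≢ (offset-< wq wp d<c ≤l) (sym eq)

  -- One family of affine maps serves both redrawings: for constant `L` class c is translated by c
  -- `L`, for linear `L` it is sheared proportionally to c. The coordinate `ξ` never changes, so the
  -- line `ξ` = 0 keeps stabbing the same edges.
  module Place (ξ η : Point → ℚ) (ξ-aff : IsAffine ξ) (η-aff : IsAffine η)
    (ξη-inj : ∀ p q → ξ p ≡ ξ q → η p ≡ η q → p ≡ q)
    (L : ℚ → ℚ) (L-mix : ∀ a b s → L (mix a b s) ≡ mix (L a) (L b) s) where

    place : ℕ → Point → Point
    place c p = ξ p , η p + ι c * L (ξ p)

    place-affine : ∀ c → IsAffineMap (place c)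
    place-affine c = ⟨ ξ-aff , +-affine η-aff (*-affine (ι c)
      (affine λ a b s → trans (cong L (on-lerp ξ-aff a b s)) (L-mix (ξ a) (ξ b) s))) ⟩-affineMap

    place-inj : ∀ c p q → place c p ≡ place c q → p ≡ q
    place-inj c p q eq = ξη-inj p q ξ≡ (+-cancelʳ (trans (cong proj₂ eq) (cong (λ x → η q + ι c * L x) (sym ξ≡))))
      where
      ξ≡ = cong proj₁ eq
      +-cancelʳ : ∀ {x y z} → x + z ≡ y + z → x ≡ y
      +-cancelʳ {x} {y} {z} e = trans (solve 2 (λ x z → x := x :+ z :- z) refl x z)
        (trans (cong (_- z) e) (solve 2 (λ x z → x :+ z :- z := x) refl y z))

    place-lerp : ∀ c a b s → place c (lerp a b s) ≡ (mix (ξ a) (ξ b) s , mix (η a) (η b) s + ι c * L (mix (ξ a) (ξ b) s))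
    place-lerp c a b s = cong₂ (λ x y → x , y + ι c * L x) (on-lerp ξ-aff a b s) (on-lerp η-aff a b s)

    lerp-within : ∀ {Y a b s} → 0ℚ ≤ s → s ≤ 1ℚ → Within Y (η a) → Within Y (η b) → Within Y (η (lerp a b s))
    lerp-within {Y} {a} {b} {s} 0≤s s≤1 wa wb = subst (Within Y) (sym (on-lerp η-aff a b s)) (mix-within 0≤s s≤1 wa wb)

    module _ {Y : ℚ} {c d : ℕ} (c≢d : c ≢ d) where

      place-disjoint : ∀ {p q} → Within Y (η p) → Within Y (η q) → Far Y (L (ξ p)) → place c p ≢ place d q
      place-disjoint {p} {q} wp wq far eq = offset-≢ wp wq far c≢d
        (trans (cong proj₂ eq) (cong (λ x → η q + ι d * L x) (sym (cong proj₁ eq))))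

      -- `Far` is asked for only at the abscissa of the vertex. A shear vanishes on the axis, so the
      -- condition at every abscissa, as in `place-¬cross`, is available only for translations.
      place-no-pass : ∀ {a b p} → Within Y (η a) → Within Y (η b) → Within Y (η p) → Far Y (L (ξ p)) →
        ¬ OnOpenSeg (place c p) (place d a) (place d b)
      place-no-pass {a} {b} {p} wa wb wp far (s , 0<s , s<1 , eq) =
        place-disjoint wp (lerp-within (<⇒≤ 0<s) (<⇒≤ s<1) wa wb) far (trans (sym eq) (sym (place-affine d a b s)))

      place-¬cross : (∀ x → Far Y (L x)) → ∀ {a b p q} →
        Within Y (η a) → Within Y (η b) → Within Y (η p) → Within Y (η q) →
        ¬ CrossPt (place c a) (place c b) (place d p) (place d q)
      place-¬cross far {a} {b} {p} {q} wa wb wp wq (_ , (s , 0<s , s<1 , refl) , (t , 0<t , t<1 , eq)) =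
        place-disjoint (lerp-within (<⇒≤ 0<s) (<⇒≤ s<1) wa wb) (lerp-within (<⇒≤ 0<t) (<⇒≤ t<1) wp wq) (far _)
          (trans (place-affine c a b s) (trans (sym eq) (sym (place-affine d p q t))))

    -- Class d is displaced more than class c, downwards at the left ends and upwards at the right
    -- ends, so the two segments exchange their vertical order on the way.
    place-cross : ∀ {Y c d} → c ℕ.< d → ∀ {a b p q} →
      ξ a < 0ℚ → 0ℚ < ξ b → ξ p < 0ℚ → 0ℚ < ξ q →
      L (ξ a) ≤ - (Y + Y) → Y + Y ≤ L (ξ b) → L (ξ p) ≤ - (Y + Y) → Y + Y ≤ L (ξ q) →
      Within Y (η a) → Within Y (η b) → Within Y (η p) → Within Y (η q) →
      CrossPt (place d p) (place d q) (place c a) (place c b)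
    place-cross {Y} {c} {d} c<d {a} {b} {p} {q} a<0 0<b p<0 0<q La Lb Lp Lq wa wb wp wq =
      alternating⇒cross p<0 0<q a<0 0<b
        (λ s t 0≤s s≤1 0≤t t≤1 e end → subst₂ _<_ (height d p q s) (height c a b t)
          (subst (λ x → mix (η p) (η q) s + ι d * L (mix (ξ p) (ξ q) s) < mix (η a) (η b) t + ι c * L x) e
            (offset-> (mix-within 0≤t t≤1 wa wb) (mix-within 0≤s s≤1 wp wq) c<d (left end))))
        (λ s t 0≤s s≤1 0≤t t≤1 e end → subst₂ _<_ (height c a b t) (height d p q s)
          (subst (λ x → mix (η a) (η b) t + ι c * L x < mix (η p) (η q) s + ι d * L (mix (ξ p) (ξ q) s)) e
            (offset-< (mix-within 0≤t t≤1 wa wb) (mix-within 0≤s s≤1 wp wq) c<d (right end))))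
      where
      height : ∀ c a b s →
        mix (η a) (η b) s + ι c * L (mix (ξ a) (ξ b) s) ≡ mix (η a + ι c * L (ξ a)) (η b + ι c * L (ξ b)) s
      height c a b s = cong proj₂ (trans (sym (place-lerp c a b s)) (place-affine c a b s))
      left : ∀ {x} → x ≡ ξ p ⊎ x ≡ ξ a → L x ≤ - (Y + Y)
      left (inj₁ refl) = Lp
      left (inj₂ refl) = La
      right : ∀ {x} → x ≡ ξ q ⊎ x ≡ ξ b → Y + Y ≤ L x
      right (inj₁ refl) = Lq
      right (inj₂ refl) = Lb

open import Data.Bool using (Bool; true; false; T; _∧_; _∨_; not)
import Data.Bool.Properties as Bool
open import Data.Empty using (⊥; ⊥-elim)
open import Data.Fin using (Fin; zero; suc; toℕ; punchOut; inject≤; splitAt; join; combine; _↑ˡ_; _≟_)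
open import Data.Fin.Properties using (injective⇒≤; punchOut-injective; any?; all?; ¬∀⟶∃¬; sequence; toℕ<n; toℕ-injective;
  join-splitAt; splitAt-join; splitAt-↑ˡ; toℕ-↑ˡ; ↑ˡ-injective; toℕ-combine)
open import Data.List using (List; []; _∷_; length; map; filterᵇ; lookup; allFin; cartesianProduct)
open import Data.List.Properties using (filter-notAll; length-filter; length-tabulate; length-++; length-map)
open import Data.List.Membership.Propositional using (_∈_; lose)
open import Data.List.Membership.Propositional.Properties using (∈-filter⁺; ∈-filter⁻; ∈-allFin; ∈-cartesianProduct⁺; ∈-lookup)
open import Data.List.Relation.Unary.All as All using ()
open import Data.List.Relation.Unary.AllPairs using (_∷_)
open import Data.List.Relation.Unary.Any using (here; there; index)
open import Data.List.Relation.Unary.Any.Properties using (lookup-index)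
open import Data.List.Relation.Unary.Unique.Propositional using (Unique)
open import Data.List.Relation.Unary.Unique.Propositional.Properties using (filter⁺; allFin⁺; cartesianProduct⁺)
open import Data.Nat as ℕ using (zero; suc; _^_; _<_; z≤n; s≤s; _<ᵇ_)
open import Data.Nat using (ℕ; _+_; _*_; _≤_)
open import Data.Nat.Logarithm using (⌊log₂_⌋; ⌊log₂⌋-mono-≤; ⌊log₂[2^n]⌋≡n)
open import Data.Nat.Properties as ℕ using (≤-refl; ≤-trans; <-≤-trans)
import Data.Nat.Solver as ℕS
open import Data.Product using (∃-syntax; Σ; _×_; _,_; proj₁; proj₂)
open import Data.Rational as ℚ using (ℚ; 0ℚ; 1ℚ)
import Data.Rational.Properties as ℚ
open import Data.Rational.Solver using (module +-*-Solver)
open import Data.Sum using (_⊎_; inj₁; inj₂; [_,_]′)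
open import Effect.Monad using (RawMonad)
open import Function using (id; Equivalence)
open import Relation.Binary.Definitions using (Tri; tri<; tri≈; tri>)
open import Relation.Binary.PropositionalEquality
open import Relation.Nullary using (¬_; Dec; yes; no; contradiction; does)
open import Relation.Nullary.Decidable using (¬¬-excluded-middle; T?; decidable-stable; dec-true; dec-false; _⊎-dec_; _×-dec_; ¬?)
open import Relation.Nullary.Negation using (¬¬-Monad)
open PlaneGeometry

-- Double negation, counting and ranks.

¬¬-choice : ∀ {n} {P : Fin n → Set} → (∀ i → ¬ ¬ P i) → ¬ ¬ (∀ i → P i)
¬¬-choice = sequence (RawMonad.rawApplicative ¬¬-Monad)

¬¬-≤ : ∀ {m n} → ¬ ¬ (m ≤ n) → m ≤ n
¬¬-≤ {m} {n} = decidable-stable (m ℕ.≤? n)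

≡true⇒T : ∀ {b} → b ≡ true → T b
≡true⇒T = Equivalence.from Bool.T-≡

T⇒≡true : ∀ {b} → T b → b ≡ true
T⇒≡true = Equivalence.to Bool.T-≡

module _ {A : Set} where

  count : (A → Bool) → List A → ℕ
  count P xs = length (filterᵇ P xs)

  count-⊎ : ∀ {P Q R : A → Bool} → (∀ x → P x ≡ true → Q x ≡ true ⊎ R x ≡ true) →
    ∀ xs → count P xs ≤ count Q xs + count R xs
  count-⊎ P⊆Q∪R [] = z≤n
  count-⊎ {P} {Q} {R} P⊆Q∪R (x ∷ xs) with ih ← count-⊎ {P} {Q} {R} P⊆Q∪R xs
    with P x in px | Q x in qx | R x in rx
  ... | false | false | false = ih
  ... | false | false | true = ≤-trans ih (ℕ.+-monoʳ-≤ (count Q xs) (ℕ.n≤1+n _))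
  ... | false | true | false = ℕ.m≤n⇒m≤1+n ih
  ... | false | true | true = ℕ.m≤n⇒m≤1+n (≤-trans ih (ℕ.+-monoʳ-≤ (count Q xs) (ℕ.n≤1+n _)))
  ... | true | true | false = s≤s ih
  ... | true | true | true = s≤s (≤-trans ih (ℕ.+-monoʳ-≤ (count Q xs) (ℕ.n≤1+n _)))
  ... | true | false | true = subst (suc (count P xs) ≤_) (sym (ℕ.+-suc (count Q xs) _)) (s≤s ih)
  ... | true | false | false with P⊆Q∪R x px
  ...   | inj₁ qx′ = contradiction (trans (sym qx) qx′) λ ()
  ...   | inj₂ rx′ = contradiction (trans (sym rx) rx′) λ ()

  count-≤ : ∀ {P Q : A → Bool} → (∀ x → P x ≡ true → Q x ≡ true) → ∀ xs → count P xs ≤ count Q xs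
  count-≤ P⊆Q [] = z≤n
  count-≤ {P} {Q} P⊆Q (x ∷ xs) with ih ← count-≤ {P} {Q} P⊆Q xs with P x in px | Q x in qx
  ... | false | false = ih
  ... | false | true = ℕ.m≤n⇒m≤1+n ih
  ... | true | true = s≤s ih
  ... | true | false = contradiction (trans (sym qx) (P⊆Q x px)) λ ()

  count-< : ∀ {P Q : A → Bool} → (∀ x → P x ≡ true → Q x ≡ true) → ∀ {a xs} → a ∈ xs →
    P a ≡ false → Q a ≡ true → count P xs < count Q xs
  count-< {P} {Q} P⊆Q {a} {_ ∷ xs} (here refl) pa qa rewrite pa | qa = s≤s (count-≤ P⊆Q xs)
  count-< {P} {Q} P⊆Q {a} {x ∷ xs} (there a∈) pa qa with ih ← count-< {P} {Q} P⊆Q a∈ pa qa with P x in px | Q x in qx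
  ... | false | false = ih
  ... | false | true = ℕ.m≤n⇒m≤1+n ih
  ... | true | true = s≤s ih
  ... | true | false = contradiction (trans (sym qx) (P⊆Q x px)) λ ()

does⇒ : ∀ {P : Set} (P? : Dec P) → does P? ≡ true → P
does⇒ (yes p) _ = p

-- Ranks turn thresholds among rationals into naturals: a position for a cut can then be searched by
-- induction, and a range of slopes can be halved until one rank is left.
module Rank {A : Set} (xs : List A) (f : A → ℚ) where

  rank : ℚ → ℕ
  rank s = count (λ a → does (f a ℚ.<? s)) xs

  rank-mono-< : ∀ {a s} → a ∈ xs → f a ℚ.< s → rank (f a) < rank s
  rank-mono-< {a} {s} a∈xs fa<s = count-<
    (λ x x<a → dec-true (f x ℚ.<? s) (ℚ.<-trans (does⇒ (f x ℚ.<? f a) x<a) fa<s)) a∈xs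
    (dec-false (f a ℚ.<? f a) (ℚ.<-irrefl refl)) (dec-true (f a ℚ.<? s) fa<s)

  rank-cancel-≤ : ∀ {a s} → a ∈ xs → rank s ≤ rank (f a) → s ℚ.≤ f a
  rank-cancel-≤ a∈xs le = ℚ.≮⇒≥ λ fa<s → ℕ.<⇒≱ (rank-mono-< a∈xs fa<s) le

  rank-cancel-< : ∀ {a b} → rank (f a) < rank (f b) → f a ℚ.< f b
  rank-cancel-< {a} {b} lt = ℚ.≰⇒> λ fb≤fa → ℕ.<⇒≱ lt (count-≤
    (λ x x<b → dec-true (f x ℚ.<? f a) (ℚ.<-≤-trans (does⇒ (f x ℚ.<? f b) x<b) fb≤fa)) xs)

  rank<length : ∀ {a} → a ∈ xs → rank (f a) < length xs
  rank<length {a} a∈xs = filter-notAll (λ x → T? (does (f x ℚ.<? f a))) xs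
    (lose a∈xs λ t → ℚ.<-irrefl refl (does⇒ (f a ℚ.<? f a) (T⇒≡true t)))

lookup-injective : ∀ {A : Set} {xs : List A} → Unique xs → ∀ i j → lookup xs i ≡ lookup xs j → i ≡ j
lookup-injective (_ ∷ _) zero zero _ = refl
lookup-injective (x∉ ∷ _) zero (suc j) e = contradiction e (All.lookup x∉ (∈-lookup j))
lookup-injective (x∉ ∷ _) (suc i) zero e = contradiction (sym e) (All.lookup x∉ (∈-lookup i))
lookup-injective (_ ∷ u) (suc i) (suc j) e = cong suc (lookup-injective u i j e)

count-inj : ∀ {A B : Set} {P : A → Bool} {Q : B → Bool} (f : A → B) {xs ys} → Unique xs → (∀ y → y ∈ ys) →
  (∀ x → P x ≡ true → Q (f x) ≡ true) →
  (∀ x y → P x ≡ true → P y ≡ true → f x ≡ f y → x ≡ y) →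
  count P xs ≤ count Q ys
count-inj {P = P} {Q} f {xs} {ys} uniq full PQ inj = injective⇒≤ {f = to} (to-inj _ _)
  where
  ps = filterᵇ P xs
  P-lookup : ∀ i → P (lookup ps i) ≡ true
  P-lookup i = T⇒≡true (proj₂ (∈-filter⁻ (λ x → T? (P x)) {xs = xs} (∈-lookup {xs = ps} i)))
  image : ∀ i → f (lookup ps i) ∈ filterᵇ Q ys
  image i = ∈-filter⁺ (λ x → T? (Q x)) (full _) (≡true⇒T (PQ _ (P-lookup i)))
  to : Fin (length ps) → Fin (count Q ys)
  to i = index (image i)
  to-inj : ∀ i j → to i ≡ to j → i ≡ j
  to-inj i j e = lookup-injective (filter⁺ (λ x → T? (P x)) uniq) i j (inj _ _ (P-lookup i) (P-lookup j)
    (trans (lookup-index (image i)) (trans (cong (lookup (filterᵇ Q ys)) e) (sym (lookup-index (image j))))))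

-- Containment up to isolated vertices.

module _ (F : GeomGraph) where

  private m = size F

  -- Injectivity is required only between vertices of F that have an edge; the images of isolated
  -- vertices are arbitrary. The relation `R` names the edges that the copy may use, so that parts
  -- of `G` need not be turned into graphs.
  WeaklyContains : (G : GeomGraph) → (Fin (size G) → Fin (size G) → Set) → Set
  WeaklyContains G R = Σ (Fin m → Fin (size G)) λ φ →
    (∀ i j k l → Edge F i j → Edge F k l → φ i ≡ φ k → i ≡ k) ×
    (∀ i j → Edge F i j → R (φ i) (φ j)) ×
    (∀ i j k l → Edge F i j → Edge F k l →
       (Cross F i j k l → Cross G (φ i) (φ j) (φ k) (φ l)) ×
       (Cross G (φ i) (φ j) (φ k) (φ l) → Cross F i j k l))

  weaken : ∀ {G} {R S : Fin (size G) → Fin (size G) → Set} → (∀ u v → R u v → S u v) →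
    WeaklyContains G R → WeaklyContains G S
  weaken R⊆S (φ , inj , edge , cross) = φ , inj , (λ i j e → R⊆S _ _ (edge i j e)) , cross

module _ {m n} (m≤n : m ≤ n) (P : Fin m → Set) (P? : ∀ i → Dec (P i)) (f : Fin m → Fin n)
  (f-inj : ∀ i j → P i → P j → f i ≡ f j → i ≡ j) where

  private
    -- Pigeonhole: if each y were hit by some x other than `v`, choosing such an x would inject
    -- `Fin n` into `Fin m` without `v`, although m ≤ n.
    fresh : (g : Fin m → Fin n) (v : Fin m) → ∃[ y ] (∀ x → x ≢ v → g x ≢ y)
    fresh g v with any? (λ y → all? (λ x → (x ≟ v) ⊎-dec ¬? (g x ≟ y)))
    ... | yes (y , free) = y , λ x x≢v → [ (λ x≡v → contradiction x≡v x≢v) , id ]′ (free x)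
    ... | no none = ⊥-elim (overfull m≤n v (λ y → proj₁ (hit y)) (λ y → proj₁ (proj₂ (hit y)))
                      (λ y z e → trans (sym (proj₂ (proj₂ (hit y)))) (trans (cong g e) (proj₂ (proj₂ (hit z))))))
      where
      hit : ∀ y → ∃[ x ] (v ≢ x × g x ≡ y)
      hit y with ¬∀⟶∃¬ m _ (λ x → (x ≟ v) ⊎-dec ¬? (g x ≟ y)) (λ free → none (y , free))
      ... | x , ¬free = x , (λ v≡x → ¬free (inj₁ (sym v≡x))) , decidable-stable (g x ≟ y) (λ ne → ¬free (inj₂ ne))
      overfull : ∀ {m n} → m ≤ n → (v : Fin m) (h : Fin n → Fin m) → (∀ y → v ≢ h y) → (∀ y z → h y ≡ h z → y ≡ z) → ⊥
      overfull {suc m} m≤n v h avoid inj = ℕ.<⇒≱ m≤n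
        (injective⇒≤ {f = λ y → punchOut (avoid y)} (λ {y} {z} e → inj y z (punchOut-injective (avoid y) (avoid z) e)))

    -- The elements outside `P` are moved to fresh values one at a time, in order. After k rounds
    -- the map is injective on `P` together with all indices below k.
    extend : ∀ k → Σ (Fin m → Fin n) λ g → (∀ i → P i → g i ≡ f i) ×
      (∀ i j → P i ⊎ toℕ i < k → P j ⊎ toℕ j < k → g i ≡ g j → i ≡ j)
    extend zero = f , (λ _ _ → refl) , λ { i j (inj₁ pi) (inj₁ pj) → f-inj i j pi pj }
    extend (suc k) with extend k | any? (λ v → (toℕ v ℕ.≟ k) ×-dec ¬? (P? v))
    ... | g , agree , inj | no none = g , agree , λ i j pi pj → inj i j (old pi) (old pj)
      where
      old : ∀ {i} → P i ⊎ toℕ i < suc k → P i ⊎ toℕ i < k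
      old (inj₁ p) = inj₁ p
      old {i} (inj₂ (s≤s i≤k)) with ℕ.m≤n⇒m<n∨m≡n i≤k
      ... | inj₁ i<k = inj₂ i<k
      ... | inj₂ i≡k = inj₁ (decidable-stable (P? i) λ ¬p → none (i , i≡k , ¬p))
    ... | g , agree , inj | yes (v , v≡k , ¬pv) = g′ , agree′ , inj′
      where
      y = proj₁ (fresh g v)
      y-fresh = proj₂ (fresh g v)
      g′ : Fin m → Fin n
      g′ i with i ≟ v
      ... | yes _ = y
      ... | no _ = g i
      agree′ : ∀ i → P i → g′ i ≡ f i
      agree′ i pi with i ≟ v
      ... | yes refl = contradiction pi ¬pv
      ... | no _ = agree i pi
      old : ∀ {i} → i ≢ v → P i ⊎ toℕ i < suc k → P i ⊎ toℕ i < k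
      old _ (inj₁ p) = inj₁ p
      old i≢v (inj₂ (s≤s i≤k)) with ℕ.m≤n⇒m<n∨m≡n i≤k
      ... | inj₁ i<k = inj₂ i<k
      ... | inj₂ i≡k = contradiction (toℕ-injective (trans i≡k (sym v≡k))) i≢v
      inj′ : ∀ i j → P i ⊎ toℕ i < suc k → P j ⊎ toℕ j < suc k → g′ i ≡ g′ j → i ≡ j
      inj′ i j pi pj e with i ≟ v | j ≟ v
      ... | yes refl | yes refl = refl
      ... | yes refl | no j≢v = contradiction (sym e) (y-fresh j j≢v)
      ... | no i≢v | yes refl = contradiction e (y-fresh i i≢v)
      ... | no i≢v | no j≢v = inj i j (old i≢v pi) (old j≢v pj) e

  extend-injection : Σ (Fin m → Fin n) λ g → (∀ i → P i → g i ≡ f i) × (∀ i j → g i ≡ g j → i ≡ j)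
  extend-injection with extend m
  ... | g , agree , inj = g , agree , λ i j → inj i j (inj₂ (toℕ<n i)) (inj₂ (toℕ<n j))

contains : ∀ (F G : GeomGraph) → size F ≤ size G → WeaklyContains F G (Edge G) → Contains G F
contains F G m≤n (φ , inj , edge , cross) = ψ , ψ-inj ,
  (λ i j e → subst₂ (Edge G) (sym (agree i (j , e))) (sym (agree j (i , flip e))) (edge i j e)) ,
  λ i j k l e e′ → let open Agree e e′ in
    (λ c → subst id (sym ≡C) (proj₁ (cross i j k l e e′) c)) , (λ c → proj₂ (cross i j k l e e′) (subst id ≡C c))
  where
  flip : ∀ {i j} → Edge F i j → Edge F j i
  flip {i} {j} e = trans (adj-sym F j i) e
  NonIsolated : Fin (size F) → Set
  NonIsolated i = ∃[ j ] Edge F i j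
  ext = extend-injection m≤n NonIsolated (λ i → any? λ j → adj F i j Bool.≟ true) φ
    (λ { i j (i′ , e) (j′ , e′) → inj i i′ j j′ e e′ })
  ψ = proj₁ ext
  agree = proj₁ (proj₂ ext)
  ψ-inj = proj₂ (proj₂ ext)
  module Agree {i j k l} (e : Edge F i j) (e′ : Edge F k l) where
    ≡C : Cross G (ψ i) (ψ j) (ψ k) (ψ l) ≡ Cross G (φ i) (φ j) (φ k) (φ l)
    ≡C rewrite agree i (j , e) | agree j (i , flip e) | agree k (l , e′) | agree l (k , flip e′) = refl

WeaklyContains-edgeless : ∀ (F G : GeomGraph) {R} → (∀ i j → ¬ Edge F i j) →
  (Fin (size F) → Fin (size G)) → WeaklyContains F G R
WeaklyContains-edgeless F G none φ = φ , (λ i j k l e → contradiction e (none i j)) , (λ i j e → contradiction e (none i j)) ,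
  λ i j k l e → contradiction e (none i j)

open⇒closed : ∀ {p a b} → OnOpenSeg p a b → OnClosedSeg p a b
open⇒closed (s , 0<s , s<1 , eq) = s , ℚ.<⇒≤ 0<s , ℚ.<⇒≤ s<1 , eq

-- Gluing two copies of F, and cutting a graph along an affine functional.

Separated : (G : GeomGraph) (R S : Fin (size G) → Fin (size G) → Set) → Set
Separated G R S = ∀ u v w z → R u v → S w z → u ≢ w × ¬ Cross G u v w z

module TwoCopies {F F₂ : GeomGraph} (copies : IsTwoDisjointCopies F F₂) where

  private
    φ₁ = proj₁ copies
    φ₂ = proj₁ (proj₂ copies)
    emb₁ = proj₁ (proj₂ (proj₂ copies))
    emb₂ = proj₁ (proj₂ (proj₂ (proj₂ copies)))
    φ₁≢φ₂ = proj₁ (proj₂ (proj₂ (proj₂ (proj₂ copies))))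
    cover = proj₁ (proj₂ (proj₂ (proj₂ (proj₂ (proj₂ copies)))))
    edge-origin = proj₁ (proj₂ (proj₂ (proj₂ (proj₂ (proj₂ (proj₂ copies))))))
    disjoint = proj₂ (proj₂ (proj₂ (proj₂ (proj₂ (proj₂ (proj₂ copies))))))
    m = size F

    ¬cross₁₂ : ∀ {i j k l} → Edge F i j → Edge F k l → ¬ Cross F₂ (φ₁ i) (φ₁ j) (φ₂ k) (φ₂ l)
    ¬cross₁₂ e e′ (p , o , o′) = disjoint _ _ _ _ e e′ (p , open⇒closed o , open⇒closed o′)

  copies-size : size F₂ ≤ m + m
  copies-size = injective⇒≤ (λ {u} {v} → preimage-inj u v)
    where
    side : Fin (size F₂) → Fin m ⊎ Fin m
    side v with cover v
    ... | i , inj₁ _ = inj₁ i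
    ... | i , inj₂ _ = inj₂ i
    back : Fin m ⊎ Fin m → Fin (size F₂)
    back = [ φ₁ , φ₂ ]′
    back-side : ∀ v → back (side v) ≡ v
    back-side v with cover v
    ... | i , inj₁ e = e
    ... | i , inj₂ e = e
    preimage-inj : ∀ u v → join m m (side u) ≡ join m m (side v) → u ≡ v
    preimage-inj u v e = trans (sym (back-side u)) (trans (cong back side≡) (back-side v))
      where
      side≡ : side u ≡ side v
      side≡ = trans (sym (splitAt-join m m (side u))) (trans (cong (splitAt m) e) (splitAt-join m m (side v)))

  -- Edges from different copies inside `F₂` never cross, and `Separated` guarantees the same for
  -- their images as well as distinct ends. Within one copy crossings are compared through F.
  join-copies : ∀ {G} {R S Q : Fin (size G) → Fin (size G) → Set} → Separated G R S →
    (∀ u v → R u v → Q u v) → (∀ u v → S u v → Q u v) →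
    WeaklyContains F G R → WeaklyContains F G S → WeaklyContains F₂ G Q
  join-copies {G} {R} {S} {Q} sep R⊆Q S⊆Q (ψ₁ , inj₁′ , edge₁ , cross₁) (ψ₂ , inj₂′ , edge₂ , cross₂) =
    ψ , ψ-inj , ψ-edge , ψ-cross
    where
    ψ : Fin (size F₂) → Fin (size G)
    ψ v with cover v
    ... | i , inj₁ _ = ψ₁ i
    ... | i , inj₂ _ = ψ₂ i
    ψφ₁ : ∀ i → ψ (φ₁ i) ≡ ψ₁ i
    ψφ₁ i with cover (φ₁ i)
    ... | i′ , inj₁ e = cong ψ₁ (proj₁ emb₁ i′ i e)
    ... | i′ , inj₂ e = contradiction (sym e) (φ₁≢φ₂ i i′)
    ψφ₂ : ∀ i → ψ (φ₂ i) ≡ ψ₂ i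
    ψφ₂ i with cover (φ₂ i)
    ... | i′ , inj₁ e = contradiction e (φ₁≢φ₂ i′ i)
    ... | i′ , inj₂ e = cong ψ₂ (proj₁ emb₂ i′ i e)
    ψ-inj : ∀ u v w z → Edge F₂ u v → Edge F₂ w z → ψ u ≡ ψ w → u ≡ w
    ψ-inj u v w z e e′ eq with edge-origin u v e | edge-origin w z e′
    ... | inj₁ (i , j , f , refl , refl) | inj₁ (k , l , f′ , refl , refl) =
      cong φ₁ (inj₁′ i j k l f f′ (trans (sym (ψφ₁ i)) (trans eq (ψφ₁ k))))
    ... | inj₂ (i , j , f , refl , refl) | inj₂ (k , l , f′ , refl , refl) =
      cong φ₂ (inj₂′ i j k l f f′ (trans (sym (ψφ₂ i)) (trans eq (ψφ₂ k))))
    ... | inj₁ (i , j , f , refl , refl) | inj₂ (k , l , f′ , refl , refl) =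
      contradiction (trans (sym (ψφ₁ i)) (trans eq (ψφ₂ k))) (proj₁ (sep _ _ _ _ (edge₁ i j f) (edge₂ k l f′)))
    ... | inj₂ (i , j , f , refl , refl) | inj₁ (k , l , f′ , refl , refl) =
      contradiction (trans (sym (ψφ₁ k)) (trans (sym eq) (ψφ₂ i))) (proj₁ (sep _ _ _ _ (edge₁ k l f′) (edge₂ i j f)))
    ψ-edge : ∀ u v → Edge F₂ u v → Q (ψ u) (ψ v)
    ψ-edge u v e with edge-origin u v e
    ... | inj₁ (i , j , f , refl , refl) = subst₂ Q (sym (ψφ₁ i)) (sym (ψφ₁ j)) (R⊆Q _ _ (edge₁ i j f))
    ... | inj₂ (i , j , f , refl , refl) = subst₂ Q (sym (ψφ₂ i)) (sym (ψφ₂ j)) (S⊆Q _ _ (edge₂ i j f))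
    ψ-cross : ∀ u v w z → Edge F₂ u v → Edge F₂ w z →
      (Cross F₂ u v w z → Cross G (ψ u) (ψ v) (ψ w) (ψ z)) × (Cross G (ψ u) (ψ v) (ψ w) (ψ z) → Cross F₂ u v w z)
    ψ-cross u v w z e e′ with edge-origin u v e | edge-origin w z e′
    ... | inj₁ (i , j , f , refl , refl) | inj₁ (k , l , f′ , refl , refl)
      rewrite ψφ₁ i | ψφ₁ j | ψφ₁ k | ψφ₁ l =
      (λ c → proj₁ (cross₁ i j k l f f′) (proj₂ (proj₂ (proj₂ emb₁) i j k l f f′) c)) ,
      (λ c → proj₁ (proj₂ (proj₂ emb₁) i j k l f f′) (proj₂ (cross₁ i j k l f f′) c))
    ... | inj₂ (i , j , f , refl , refl) | inj₂ (k , l , f′ , refl , refl)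
      rewrite ψφ₂ i | ψφ₂ j | ψφ₂ k | ψφ₂ l =
      (λ c → proj₁ (cross₂ i j k l f f′) (proj₂ (proj₂ (proj₂ emb₂) i j k l f f′) c)) ,
      (λ c → proj₁ (proj₂ (proj₂ emb₂) i j k l f f′) (proj₂ (cross₂ i j k l f f′) c))
    ... | inj₁ (i , j , f , refl , refl) | inj₂ (k , l , f′ , refl , refl)
      rewrite ψφ₁ i | ψφ₁ j | ψφ₂ k | ψφ₂ l =
      (λ c → contradiction c (¬cross₁₂ f f′)) ,
      (λ c → contradiction c (proj₂ (sep _ _ _ _ (edge₁ i j f) (edge₂ k l f′))))
    ... | inj₂ (i , j , f , refl , refl) | inj₁ (k , l , f′ , refl , refl)
      rewrite ψφ₂ i | ψφ₂ j | ψφ₁ k | ψφ₁ l =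
      (λ c → contradiction (cross-sym c) (¬cross₁₂ f′ f)) ,
      (λ c → contradiction (cross-sym c) (proj₂ (sep _ _ _ _ (edge₁ k l f′) (edge₂ i j f))))

Within₂ : ∀ {n} → (Fin n → Fin n → Set) → (Fin n → Bool) → Fin n → Fin n → Set
Within₂ R P u v = R u v × P u ≡ true × P v ≡ true

-- The one vertex that may be neither low nor high is the vertex whose arrival on the low side
-- completes the first copy of F.
record Cut (F G : GeomGraph) (R : Fin (size G) → Fin (size G) → Set) (g : Point → ℚ) : Set where
  field
    lo hi : Fin (size G) → Bool
    lo-< : ∀ u w → lo u ≡ true → lo w ≡ false → g (pos G u) ℚ.< g (pos G w)
    hi-> : ∀ u w → hi u ≡ true → hi w ≡ false → g (pos G w) ℚ.< g (pos G u)
    lo∧hi : ∀ u → lo u ≡ true → hi u ≡ true → ⊥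
    middle : ∀ u w → lo u ≡ false → hi u ≡ false → lo w ≡ false → hi w ≡ false → u ≡ w
    lo-free : ¬ WeaklyContains F G (Within₂ R lo)
    hi-free : ¬ WeaklyContains F G (Within₂ R hi)

-- `Q` is not decidable, so climbing from 0 finds a jump from failure to success only up to double
-- negation.
least : (Q : ℕ → Set) → ¬ Q 0 → ∀ N → ¬ ¬ (¬ Q N ⊎ ∃[ t ] (¬ Q t × Q (suc t)))
least Q ¬Q0 zero k = k (inj₁ ¬Q0)
least Q ¬Q0 (suc N) k = least Q ¬Q0 N λ
  { (inj₂ step) → k (inj₂ step)
  ; (inj₁ ¬QN) → ¬¬-excluded-middle {A = Q (suc N)} λ
      { (yes q) → k (inj₂ (N , ¬QN , q)) ; (no ¬q) → k (inj₁ ¬q) } }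

module _ {F F₂ : GeomGraph} (copies : IsTwoDisjointCopies F F₂)
  (has-edge : ¬ (∀ i j → ¬ Edge F i j)) (G : GeomGraph) where

  -- Take t such that the ranks below t carry no copy of F but the ranks up to t do. The functional
  -- `g` separates the latter from all higher ranks, so a further copy up there would complete `F₂`.
  -- Injectivity of `g` leaves a single vertex of rank t.
  cut : ∀ {R} → ¬ WeaklyContains F₂ G R → ∀ {g} → IsAffine g → (∀ u v → g (pos G u) ≡ g (pos G v) → u ≡ v) →
    ¬ ¬ Cut F G R g
  cut {R} noF₂ {g} aff g-inj k = least Q ¬Q0 N
    λ { (inj₁ ¬QN) → k (top ¬QN) ; (inj₂ (t , ¬Qt , Qt+1)) → k (threshold t ¬Qt Qt+1) }
    where
    n = size G
    f : Fin n → ℚ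
    f u = g (pos G u)
    open Rank (allFin n) f
    r : Fin n → ℕ
    r u = rank (f u)
    N = length (allFin n)
    below : ℕ → Fin n → Bool
    below t u = does (r u ℕ.<? t)
    Q : ℕ → Set
    Q t = WeaklyContains F G (Within₂ R (below t))
    r<⇒ : ∀ u w → r u < r w → f u ℚ.< f w
    r<⇒ u w lt = rank-cancel-< {u} {w} lt
    -- This is where F must have an edge: an edgeless F is weakly contained even in the empty edge
    -- set of a graph with vertices.
    ¬Q0 : ¬ Q 0
    ¬Q0 (φ , _ , edge , _) = has-edge λ i j e → ℕ.n≮0 (does⇒ (r (φ i) ℕ.<? 0) (proj₁ (proj₂ (edge i j e))))
    ¬lo : ∀ t u → below t u ≡ false → t ≤ r u
    ¬lo t u e = ℕ.≮⇒≥ λ lt → contradiction (trans (sym (dec-true (r u ℕ.<? t) lt)) e) λ ()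
    r-inj : ∀ u w → r u ≡ r w → u ≡ w
    r-inj u w e = g-inj u w (ℚ.≤-antisym
      (rank-cancel-≤ {w} {f u} (∈-allFin w) (ℕ.≤-reflexive e))
      (rank-cancel-≤ {u} {f w} (∈-allFin u) (ℕ.≤-reflexive (sym e))))
    r<N : ∀ u → r u < N
    r<N u = rank<length {u} (∈-allFin u)
    -- There is no copy of F at all, so every vertex counts as low.
    top : ¬ Q N → Cut F G R g
    top ¬QN = record
      { lo = below N ; hi = λ _ → false
      ; lo-< = λ u w _ e → ⊥-elim (ℕ.<⇒≱ (r<N w) (¬lo N w e))
      ; hi-> = λ _ _ ()
      ; lo∧hi = λ _ _ ()
      ; middle = λ u _ e → ⊥-elim (ℕ.<⇒≱ (r<N u) (¬lo N u e))
      ; lo-free = ¬QN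
      ; hi-free = λ { (φ , _ , edge , _) → has-edge λ i j e → case-false (proj₁ (proj₂ (edge i j e))) }
      }
      where
      case-false : false ≡ true → ⊥
      case-false ()
    threshold : ∀ t → ¬ Q t → Q (suc t) → Cut F G R g
    threshold t ¬Qt Qt+1 = record
      { lo = below t ; hi = above
      ; lo-< = λ u w a b → r<⇒ u w (<-≤-trans (does⇒ (r u ℕ.<? t) a) (¬lo t w b))
      ; hi-> = λ u w a b → r<⇒ w u (ℕ.≤-<-trans (¬hi w b) (does⇒ (t ℕ.<? r u) a))
      ; lo∧hi = λ u a b → ℕ.<-asym (does⇒ (r u ℕ.<? t) a) (does⇒ (t ℕ.<? r u) b)
      ; middle = λ u w a b a′ b′ → r-inj u w (trans (ℕ.≤-antisym (¬hi u b) (¬lo t u a)) (ℕ.≤-antisym (¬lo t w a′) (¬hi w b′)))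
      ; lo-free = ¬Qt
      ; hi-free = λ hi⊇F → noF₂ (TwoCopies.join-copies {F} {F₂} copies {G} {Within₂ R (below (suc t))} {Within₂ R above}
          separated (λ _ _ → proj₁) (λ _ _ → proj₁) Qt+1 hi⊇F)
      }
      where
      above : Fin n → Bool
      above u = does (t ℕ.<? r u)
      ¬hi : ∀ u → above u ≡ false → r u ≤ t
      ¬hi u e = ℕ.≮⇒≥ λ lt → contradiction (trans (sym (dec-true (t ℕ.<? r u) lt)) e) λ ()
      lt : ∀ u w → below (suc t) u ≡ true → above w ≡ true → f u ℚ.< f w
      lt u w a b = r<⇒ u w (≤-trans (does⇒ (r u ℕ.<? suc t) a) (does⇒ (t ℕ.<? r w) b))
      separated : Separated G (Within₂ R (below (suc t))) (Within₂ R above)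
      separated u v w z (_ , u≤ , v≤) (_ , <w , <z) =
        (λ { refl → ℚ.<-irrefl refl (lt u u u≤ <w) }) ,
        separated⇒¬cross aff (lt u w u≤ <w) (lt u z u≤ <z) (lt v w v≤ <w) (lt v z v≤ <z)

pairs : ∀ n → List (Fin n × Fin n)
pairs n = cartesianProduct (allFin n) (allFin n)

∈-pairs : ∀ {n} (p : Fin n × Fin n) → p ∈ pairs n
∈-pairs {n} (i , j) = ∈-cartesianProduct⁺ {xs = allFin n} {ys = allFin n} (∈-allFin i) (∈-allFin j)

half : ∀ {n} → (Fin n → Fin n → Bool) → Fin n × Fin n → Bool
half R (i , j) = (toℕ i <ᵇ toℕ j) ∧ R i j

edges : ∀ {n} → (Fin n → Fin n → Bool) → ℕ
edges {n} R = count (half R) (pairs n)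

∧-true : ∀ {a b} → a ∧ b ≡ true → a ≡ true × b ≡ true
∧-true {true} {true} refl = refl , refl

∧-intro : ∀ {a b} → a ≡ true → b ≡ true → a ∧ b ≡ true
∧-intro refl refl = refl

-- Connectivity of the crossing relation, and redrawing many classes as one graph.

module Dichotomy (F : GeomGraph) where

  private m = size F

  -- Connectedness of the edges of F under `~`, stated through colourings instead of paths. The
  -- colouring it will be applied to records the class into which an edge of F is mapped.
  Rigid : (Fin m → Fin m → Fin m → Fin m → Set) → Set
  Rigid _~_ = ∀ (κ : Fin m → Fin m → ℕ) →
    (∀ i j k l → Edge F i j → Edge F k l → (i ~ j) k l → κ i j ≡ κ k l) →
    ∀ i j k l → Edge F i j → Edge F k l → κ i j ≡ κ k l

  -- A graph (here: on the edges of F, adjacency being crossing) or its complement is connected.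
  rigid-dichotomy : ¬ ¬ (Rigid (Cross F) ⊎ Rigid (λ i j k l → ¬ Cross F i j k l))
  rigid-dichotomy k = ¬¬-excluded-middle λ
    { (no none) → k (inj₁ λ κ resp i j k l e e′ → decidable-stable (κ i j ℕ.≟ κ k l) λ ne →
        none (κ , resp , i , j , k , l , e , e′ , ne))
    ; (yes (κ , resp , p , q , r , s , e , e′ , ne)) → k (inj₂ (complement κ resp e e′ ne)) }
    where
    -- Edges of different colours do not cross, hence are adjacent in the complement. Two edges of
    -- the same colour are joined through whichever of `p q` and `r s` has another colour.
    complement : ∀ κ → (∀ i j k l → Edge F i j → Edge F k l → Cross F i j k l → κ i j ≡ κ k l) →
      ∀ {p q r s} → Edge F p q → Edge F r s → κ p q ≢ κ r s → Rigid (λ i j k l → ¬ Cross F i j k l)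
    complement κ resp {p} {q} {r} {s} e e′ ne κ′ resp′ i j k l f f′ with κ i j ℕ.≟ κ k l
    ... | no κ≢ = resp′ i j k l f f′ λ c → κ≢ (resp i j k l f f′ c)
    ... | yes κ≡ with κ i j ℕ.≟ κ p q
    ...   | no κ≢ = trans (resp′ i j p q f e λ c → κ≢ (resp i j p q f e c))
                          (sym (resp′ k l p q f′ e λ c → κ≢ (trans κ≡ (resp k l p q f′ e c))))
    ...   | yes κ≡′ = trans (resp′ i j r s f e′ λ c → ne (trans (sym κ≡′) (resp i j r s f e′ c)))
                            (sym (resp′ k l r s f′ e′ λ c → ne (trans (sym κ≡′) (trans κ≡ (resp k l r s f′ e′ c)))))

-- The plane is described by coordinates in which the stabbing line is `ξ` = 0; `G` itself stays
-- where it is.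
record Coordinates : Set where
  field
    ξ η : Point → ℚ
    ξ-affine : IsAffine ξ
    η-affine : IsAffine η
    ξη-injective : ∀ p q → ξ p ≡ ξ q → η p ≡ η q → p ≡ q

abscissa : Coordinates → (G : GeomGraph) → Fin (size G) → ℚ
abscissa coords G u = Coordinates.ξ coords (pos G u)

module Redraw (F : GeomGraph) (has-edge : ¬ (∀ i j → ¬ Edge F i j)) (G : GeomGraph) (coords : Coordinates)
  (x≢0 : ∀ u → abscissa coords G u ≢ 0ℚ) {e : ℕ}
  (ex : ∀ H → size H ≡ size G + size G → LineStabbed H → ¬ Contains H F → edgeCount H ≤ e) where

  open Coordinates coords

  private
    n = size G
    x y : Fin n → ℚ
    x = abscissa coords G
    y u = η (pos G u)

  Opposite : Fin n → Fin n → Set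
  Opposite u v = x u ℚ.< 0ℚ × 0ℚ ℚ.< x v ⊎ x v ℚ.< 0ℚ × 0ℚ ℚ.< x u

  opposite-sym : ∀ {u v} → Opposite u v → Opposite v u
  opposite-sym (inj₁ o) = inj₂ o
  opposite-sym (inj₂ o) = inj₁ o

  module _ {K : ℕ} (c : Fin n → Fin K) (S : Fin n → Fin n → Bool)
    (S-sym : ∀ u v → S u v ≡ S v u)
    (S⊆G : ∀ u v → S u v ≡ true → Edge G u v)
    (S-class : ∀ u v → S u v ≡ true → c u ≡ c v)
    (S-opposite : ∀ u v → S u v ≡ true → Opposite u v)
    (free : ∀ i → ¬ WeaklyContains F G (λ u v → S u v ≡ true × c u ≡ i)) where

    private
      -- Each vertex has an isolated twin, which only serves to double the order.
      V = Fin n ⊎ Fin n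

      base : V → Fin n
      base (inj₁ u) = u
      base (inj₂ u) = u

      label : V → ℕ
      label (inj₁ u) = toℕ (c u)
      -- The twins form one extra class, with the first label that no real class has, and so are
      -- moved away from the originals.
      label (inj₂ _) = K

      A : V → V → Bool
      A (inj₁ u) (inj₁ v) = S u v
      A _ _ = false

      A-sym : ∀ a b → A a b ≡ A b a
      A-sym (inj₁ u) (inj₁ v) = S-sym u v
      A-sym (inj₁ _) (inj₂ _) = refl
      A-sym (inj₂ _) (inj₁ _) = refl
      A-sym (inj₂ _) (inj₂ _) = refl

      A-irrefl : ∀ a → A a a ≡ false
      A-irrefl (inj₂ _) = refl
      A-irrefl (inj₁ u) with S u u in eq
      ... | false = refl
      ... | true = trans (sym (S⊆G u u eq)) (adj-irrefl G u)

      A⇒S : ∀ a b → A a b ≡ true → S (base a) (base b) ≡ true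
      A⇒S (inj₁ _) (inj₁ _) e = e

      A-label : ∀ a b → A a b ≡ true → label a ≡ label b
      A-label (inj₁ u) (inj₁ v) e = cong toℕ (S-class u v e)

      A-base-inj : ∀ a b a′ b′ → A a b ≡ true → A a′ b′ ≡ true → base a ≡ base a′ → a ≡ a′
      A-base-inj (inj₁ _) (inj₁ _) (inj₁ _) (inj₁ _) _ _ refl = refl

      base-label-inj : ∀ a b → label a ≡ label b → base a ≡ base b → a ≡ b
      base-label-inj (inj₁ u) (inj₁ .u) _ refl = refl
      base-label-inj (inj₂ u) (inj₂ .u) _ refl = refl
      base-label-inj (inj₁ u) (inj₂ .u) l refl = contradiction l (ℕ.<⇒≢ (toℕ<n (c u)))
      base-label-inj (inj₂ u) (inj₁ .u) l refl = contradiction (sym l) (ℕ.<⇒≢ (toℕ<n (c u)))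

      split-inj : ∀ i j → splitAt n {n} i ≡ splitAt n j → i ≡ j
      split-inj i j eq = trans (sym (join-splitAt n n i)) (trans (cong (join n n) eq) (join-splitAt n n j))

      module Drawing {Y : ℚ} (within : ∀ u → Within Y (y u))
        (L : ℚ → ℚ) (L-mix : ∀ a b s → L (mix a b s) ≡ mix (L a) (L b) s) (far : ∀ u → Far Y (L (x u))) where

        open Place ξ η ξ-affine η-affine ξη-injective L L-mix

        P : V → Point
        P a = place (label a) (pos G (base a))

        P-inj : ∀ a b → P a ≡ P b → a ≡ b
        P-inj a b eq with label a ℕ.≟ label b
        ... | no l≢ = contradiction eq (place-disjoint l≢ (within _) (within _) (far _))
        ... | yes l≡ = base-label-inj a b l≡ (pos-inj G _ _ (place-inj (label a) _ _
                (trans eq (cong (λ l → place l (pos G (base b))) (sym l≡)))))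

        P-no-pass : ∀ a b w → A a b ≡ true → ¬ OnOpenSeg (P w) (P a) (P b)
        P-no-pass a b w e o with label w ℕ.≟ label a
        ... | no l≢ = place-no-pass l≢ (within _) (within _) (within _) (far _)
                (subst (λ l → OnOpenSeg (P w) (P a) (place l (pos G (base b)))) (sym (A-label a b e)) o)
        ... | yes l≡ = no-pass G _ _ (base w) (S⊆G _ _ (A⇒S a b e)) (open-unmap (place-affine (label a)) (place-inj (label a))
                (subst₂ (λ k l → OnOpenSeg (place k (pos G (base w))) (P a) (place l (pos G (base b)))) l≡ (sym (A-label a b e)) o))

        H : GeomGraph
        H = record
          { size = n + n
          ; pos = λ i → P (splitAt n i)
          ; pos-inj = λ i j eq → split-inj i j (P-inj _ _ eq)
          ; adj = λ i j → A (splitAt n i) (splitAt n j)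
          ; adj-sym = λ i j → A-sym (splitAt n i) (splitAt n j)
          ; adj-irrefl = λ i → A-irrefl (splitAt n i)
          ; no-pass = λ i j v → P-no-pass (splitAt n i) (splitAt n j) (splitAt n v)
          }

        -- The line is x = 0: the first coordinate of `P a` is still the abscissa of `base a`, and
        -- the ends of each edge have abscissae of opposite sign.
        stabbed : LineStabbed H
        stabbed = 1ℚ , 0ℚ , 0ℚ , (λ { (() , _) }) , λ i j e → meet (splitAt n i) (splitAt n j) e
          where
          on-axis : ∀ {p : Point} → proj₁ p ≡ 0ℚ → 1ℚ ℚ.* proj₁ p ℚ.+ 0ℚ ℚ.* proj₂ p ≡ 0ℚ
          on-axis {p₁ , p₂} refl = trans (cong₂ ℚ._+_ (ℚ.*-identityˡ 0ℚ) (ℚ.*-zeroˡ p₂)) (ℚ.+-identityˡ 0ℚ)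
          meet : ∀ a b → A a b ≡ true → ∃[ p ] (OnClosedSeg p (P a) (P b) × 1ℚ ℚ.* proj₁ p ℚ.+ 0ℚ ℚ.* proj₂ p ≡ 0ℚ)
          meet a b e with S-opposite _ _ (A⇒S a b e)
          ... | inj₁ (a<0 , 0<b) =
            let s , 0≤s , s<1 , eq = mix-solve (ℚ.<⇒≤ a<0) 0<b
            in lerp (P a) (P b) s , (s , 0≤s , ℚ.<⇒≤ s<1 , refl) , on-axis {lerp (P a) (P b) s} eq
          ... | inj₂ (b<0 , 0<a) =
            let s , 0<s , s<1 , eq = mix-solve-pos b<0 0<a
            in lerp (P b) (P a) s , (1ℚ ℚ.- s , ℚ.<⇒≤ (0<q-p s<1) , ℚ.<⇒≤ (1-s<1 0<s) , lerp-swap (P a) (P b) s) ,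
               on-axis {lerp (P b) (P a) s} eq

        -- All edges of such a copy were moved by the same injective affine map `place d`. Undoing
        -- it gives a copy with the same crossings inside one class of `G`, against `free`.
        monochromatic⇒⊥ : (emb : Contains H F) (let φ = λ i → splitAt n (proj₁ emb i)) →
          (∀ i j k l → Edge F i j → Edge F k l → label (φ i) ≡ label (φ k)) → ⊥
        monochromatic⇒⊥ (φ , φ-inj , φ-edge , φ-cross) mono = has-edge λ i j e →
          free (c (β i)) (β , β-inj , (λ k l e′ → β-edge k l e′ , toℕ-injective (class e e′)) , β-cross)
          where
          α : Fin (size F) → V
          α i = splitAt n (φ i)
          β : Fin (size F) → Fin n
          β i = base (α i)
          β-edge : ∀ i j → Edge F i j → S (β i) (β j) ≡ true
          β-edge i j e = A⇒S (α i) (α j) (φ-edge i j e)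
          A-class : ∀ a b → A a b ≡ true → toℕ (c (base a)) ≡ label a
          A-class (inj₁ _) (inj₁ _) _ = refl
          class : ∀ {i j k l} → Edge F i j → Edge F k l → toℕ (c (β k)) ≡ toℕ (c (β i))
          class {i} {j} {k} {l} e e′ = trans (A-class (α k) (α l) (φ-edge k l e′))
            (trans (mono k l i j e′ e) (sym (A-class (α i) (α j) (φ-edge i j e))))
          β-inj : ∀ i j k l → Edge F i j → Edge F k l → β i ≡ β k → i ≡ k
          β-inj i j k l e e′ eq = φ-inj i k (split-inj _ _
            (A-base-inj (α i) (α j) (α k) (α l) (φ-edge i j e) (φ-edge k l e′) eq))
          β-cross : ∀ i j k l → Edge F i j → Edge F k l →
            (Cross F i j k l → Cross G (β i) (β j) (β k) (β l)) × (Cross G (β i) (β j) (β k) (β l) → Cross F i j k l)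
          β-cross i j k l e e′ =
            (λ cr → cross-unmap (place-affine d) (place-inj d) (subst id (sym ≡C) (proj₁ (φ-cross i j k l e e′) cr))) ,
            (λ cr → proj₂ (φ-cross i j k l e e′) (subst id ≡C (cross-map (place-affine d) cr)))
            where
            d = label (α i)
            ≡C : CrossPt (place d (pos G (β i))) (place d (pos G (β j))) (place d (pos G (β k))) (place d (pos G (β l)))
               ≡ CrossPt (P (α i)) (P (α j)) (P (α k)) (P (α l))
            ≡C = trans (cong (λ d′ → CrossPt (P (α i)) (place d′ (pos G (β j))) (place d (pos G (β k))) (place d (pos G (β l))))
                        (A-label (α i) (α j) (φ-edge i j e)))
                  (trans (cong (λ d′ → CrossPt (P (α i)) (P (α j)) (place d′ (pos G (β k))) (place d (pos G (β l))))
                        (mono i j k l e e′))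
                    (cong (λ d′ → CrossPt (P (α i)) (P (α j)) (P (α k)) (place d′ (pos G (β l))))
                        (trans (mono i j k l e e′) (A-label (α k) (α l) (φ-edge k l e′)))))

        edges≤ : ¬ Contains H F → edges S ≤ e
        edges≤ ¬H⊇F = ≤-trans (count-inj lift (cartesianProduct⁺ (allFin⁺ n) (allFin⁺ n)) ∈-pairs
          (λ { (u , v) p → lift-edge u v p })
          (λ { (u , v) (u′ , v′) _ _ eq →
            cong₂ _,_ (↑ˡ-injective n u u′ (cong proj₁ eq)) (↑ˡ-injective n v v′ (cong proj₂ eq)) }))
          (ex H refl stabbed ¬H⊇F)
          where
          lift : Fin n × Fin n → Fin (n + n) × Fin (n + n)
          lift (u , v) = u ↑ˡ n , v ↑ˡ n
          lift-edge : ∀ u v → half S (u , v) ≡ true → half (adj H) (lift (u , v)) ≡ true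
          lift-edge u v p rewrite toℕ-↑ˡ u n | toℕ-↑ˡ v n | splitAt-↑ˡ n u n | splitAt-↑ˡ n v n = p

      Y-within : ∃[ Y ] (∀ u → Within Y (y u))
      Y-within =
        let B₁ , y<B₁ = bounded y
            B₂ , -y<B₂ = bounded (λ u → ℚ.- y u)
            Y = B₁ ℚ.⊔ B₂
        in Y , λ u → subst (ℚ.- Y ℚ.<_) (neg-neg (y u))
             (ℚ.neg-antimono-< (ℚ.<-≤-trans (-y<B₂ u) (ℚ.p≤q⊔p B₁ B₂))) , ℚ.<-≤-trans (y<B₁ u) (ℚ.p≤p⊔q B₁ B₂)
        where
        open +-*-Solver
        neg-neg : ∀ q → ℚ.- (ℚ.- q) ≡ q
        neg-neg = solve 1 (λ q → :- (:- q) := q) refl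

    -- Colour the edges of F by the label of their image in the drawing. Equal colours are forced on
    -- crossing edges by `stacked`, on non-crossing edges by `fanned`, and the matching form of
    -- `Rigid` makes the copy monochromatic.
    redraw : edges S ≤ e
    redraw = ¬¬-≤ λ k → Dichotomy.rigid-dichotomy F λ
      { (inj₁ rigid) → k (stacked rigid) ; (inj₂ rigid) → k (fanned rigid) }
      where
      Y = proj₁ Y-within
      within = proj₂ Y-within
      2Y = Y ℚ.+ Y

      -- Distinct classes are stacked on top of each other, so that they are disjoint.
      stacked : Dichotomy.Rigid F (Cross F) → edges S ≤ e
      stacked rigid = edges≤ λ { emb@(φ , _ , φ-edge , φ-cross) → monochromatic⇒⊥ emb
          (rigid (λ i _ → label (splitAt n (φ i))) λ i j k l e e′ cr →
            decidable-stable (_ ℕ.≟ _) λ l≢ → disjoint (splitAt n (φ i)) (splitAt n (φ j)) (splitAt n (φ k)) (splitAt n (φ l))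
              (φ-edge i j e) (φ-edge k l e′) l≢ (proj₁ (φ-cross i j k l e e′) cr)) }
        where
        L : ℚ → ℚ
        L _ = 2Y
        L-mix : ∀ a b s → 2Y ≡ mix 2Y 2Y s
        L-mix a b s = on-lerp (const-affine 2Y) (0ℚ , 0ℚ) (0ℚ , 0ℚ) s
        open Drawing within L L-mix (λ _ → inj₂ ℚ.≤-refl)
        open Place ξ η ξ-affine η-affine ξη-injective L L-mix
        disjoint : ∀ a b a′ b′ → A a b ≡ true → A a′ b′ ≡ true → label a ≢ label a′ → ¬ CrossPt (P a) (P b) (P a′) (P b′)
        disjoint a b a′ b′ e e′ l≢ cr = place-¬cross l≢ (λ _ → inj₂ ℚ.≤-refl) (within _) (within _) (within _) (within _)
          (subst₂ (λ l l′ → CrossPt (P a) (place l (pos G (base b))) (P a′) (place l′ (pos G (base b′))))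
            (sym (A-label a b e)) (sym (A-label a′ b′ e′)) cr)

      -- Distinct classes are sheared so differently that any edge of one crosses any edge of another.
      fanned : Dichotomy.Rigid F (λ i j k l → ¬ Cross F i j k l) → edges S ≤ e
      fanned rigid = edges≤ λ { emb@(φ , _ , φ-edge , φ-cross) → monochromatic⇒⊥ emb
          (rigid (λ i _ → label (splitAt n (φ i))) λ i j k l e e′ ¬cr →
            decidable-stable (_ ℕ.≟ _) λ l≢ → ¬cr (proj₂ (φ-cross i j k l e e′)
              (crossing (splitAt n (φ i)) (splitAt n (φ j)) (splitAt n (φ k)) (splitAt n (φ l)) (φ-edge i j e) (φ-edge k l e′) l≢))) }
        where
        open +-*-Solver
        -- The shear has to displace every vertex by at least 2Y per class, so its factor must
        -- exceed 2Y / x for vertices right of the axis and 2Y / (-x) for those left of it.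
        B₁ = bounded (λ u → 2Y ℚ.* inv (x u))
        B₂ = bounded (λ u → 2Y ℚ.* inv (ℚ.- x u))
        s = proj₁ B₁ ℚ.⊔ proj₁ B₂
        L : ℚ → ℚ
        L z = s ℚ.* z
        L-mix : ∀ a b t → L (mix a b t) ≡ mix (L a) (L b) t
        L-mix a b t = solve 4 (λ s a b t → s :* ((con 1ℚ :- t) :* a :+ t :* b) := (con 1ℚ :- t) :* (s :* a) :+ t :* (s :* b)) refl s a b t
        scale : ∀ {w z r} → 0ℚ ℚ.< z → w ℚ.* inv z ℚ.≤ r → w ℚ.≤ r ℚ.* z
        scale {w} {z} {r} 0<z le = subst (ℚ._≤ r ℚ.* z) eq (ℚ.*-monoʳ-≤-nonNeg z {{ℚ.nonNegative (ℚ.<⇒≤ 0<z)}} le)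
          where
          eq : w ℚ.* inv z ℚ.* z ≡ w
          eq = trans (solve 3 (λ w i z → w :* i :* z := w :* (z :* i)) refl w (inv z) z)
            (trans (cong (w ℚ.*_) (*-inv (λ z≡0 → ℚ.<⇒≢ 0<z (sym z≡0)))) (ℚ.*-identityʳ w))
        right : ∀ u → 0ℚ ℚ.< x u → 2Y ℚ.≤ L (x u)
        right u 0<x = scale 0<x (ℚ.≤-trans (ℚ.<⇒≤ (proj₂ B₁ u)) (ℚ.p≤p⊔q (proj₁ B₁) (proj₁ B₂)))
        left : ∀ u → x u ℚ.< 0ℚ → L (x u) ℚ.≤ ℚ.- 2Y
        left u x<0 = subst (ℚ._≤ ℚ.- 2Y) (solve 2 (λ s x → :- (s :* (:- x)) := s :* x) refl s (x u))
          (ℚ.neg-antimono-≤ (scale (ℚ.neg-antimono-< x<0)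
            (ℚ.≤-trans (ℚ.<⇒≤ (proj₂ B₂ u)) (ℚ.p≤q⊔p (proj₁ B₁) (proj₁ B₂)))))
        far : ∀ u → Far Y (L (x u))
        far u with ℚ.<-cmp (x u) 0ℚ
        ... | tri< x<0 _ _ = inj₁ (left u x<0)
        ... | tri≈ _ x≡0 _ = contradiction x≡0 (x≢0 u)
        ... | tri> _ _ 0<x = inj₂ (right u 0<x)
        open Drawing within L L-mix far
        open Place ξ η ξ-affine η-affine ξη-injective L L-mix
        oriented : ∀ {c d} → c ℕ.< d → ∀ {u v u′ v′} → x u ℚ.< 0ℚ → 0ℚ ℚ.< x v → x u′ ℚ.< 0ℚ → 0ℚ ℚ.< x v′ →
          CrossPt (place d (pos G u′)) (place d (pos G v′)) (place c (pos G u)) (place c (pos G v))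
        oriented c<d {u} {v} {u′} {v′} u<0 0<v u′<0 0<v′ = place-cross c<d u<0 0<v u′<0 0<v′
          (left u u<0) (right v 0<v) (left u′ u′<0) (right v′ 0<v′) (within u) (within v) (within u′) (within v′)
        opposite-cross : ∀ {c d} → c ℕ.< d → ∀ {u v u′ v′} → Opposite u v → Opposite u′ v′ →
          CrossPt (place d (pos G u′)) (place d (pos G v′)) (place c (pos G u)) (place c (pos G v))
        opposite-cross c<d (inj₁ (a , b)) (inj₁ (a′ , b′)) = oriented c<d a b a′ b′
        opposite-cross c<d (inj₁ (a , b)) (inj₂ (a′ , b′)) = cross-swapˡ (oriented c<d a b a′ b′)
        opposite-cross c<d (inj₂ (a , b)) (inj₁ (a′ , b′)) = cross-swapʳ (oriented c<d a b a′ b′)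
        opposite-cross c<d (inj₂ (a , b)) (inj₂ (a′ , b′)) = cross-swapˡ (cross-swapʳ (oriented c<d a b a′ b′))
        crossing : ∀ a b a′ b′ → A a b ≡ true → A a′ b′ ≡ true → label a ≢ label a′ → CrossPt (P a) (P b) (P a′) (P b′)
        crossing a b a′ b′ e e′ l≢ = subst₂ (λ l l′ → CrossPt (P a) (place l (pos G (base b))) (P a′) (place l′ (pos G (base b′))))
            (A-label a b e) (A-label a′ b′ e′) cr
          where
          o = S-opposite _ _ (A⇒S a b e)
          o′ = S-opposite _ _ (A⇒S a′ b′ e′)
          cr : CrossPt (P a) (place (label a) (pos G (base b))) (P a′) (place (label a′) (pos G (base b′)))
          cr with ℕ.<-cmp (label a) (label a′)
          ... | tri< l< _ _ = cross-sym (opposite-cross l< o o′)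
          ... | tri≈ _ l≡ _ = contradiction l≡ l≢
          ... | tri> _ _ l> = opposite-cross l> o′ o

-- Splitting an edge set along a cut, and separating finite sets of rationals.

count-functionalˡ : ∀ {n} (P : Fin n × Fin n → Bool) →
  (∀ i j j′ → P (i , j) ≡ true → P (i , j′) ≡ true → j ≡ j′) → count P (pairs n) ≤ n
count-functionalˡ {n} P unique = ≤-trans
  (count-inj {Q = λ _ → true} proj₁ (cartesianProduct⁺ (allFin⁺ n) (allFin⁺ n)) ∈-allFin (λ _ _ → refl)
    λ { (i , j) (.i , j′) p p′ refl → cong (i ,_) (unique i j j′ p p′) })
  (≤-trans (length-filter (λ _ → T? true) (allFin n)) (ℕ.≤-reflexive (length-tabulate {n = n} λ i → i)))

count-functionalʳ : ∀ {n} (P : Fin n × Fin n → Bool) →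
  (∀ i i′ j → P (i , j) ≡ true → P (i′ , j) ≡ true → i ≡ i′) → count P (pairs n) ≤ n
count-functionalʳ {n} P unique = ≤-trans
  (count-inj {Q = λ _ → true} proj₂ (cartesianProduct⁺ (allFin⁺ n) (allFin⁺ n)) ∈-allFin (λ _ _ → refl)
    λ { (i , j) (i′ , .j) p p′ refl → cong (_, j) (unique i i′ j p p′) })
  (≤-trans (length-filter (λ _ → T? true) (allFin n)) (ℕ.≤-reflexive (length-tabulate {n = n} λ i → i)))

module Split {n} (R : Fin n → Fin n → Bool) (R-sym : ∀ u v → R u v ≡ R v u) (lo hi : Fin n → Bool)
  (lo∧hi : ∀ u → lo u ≡ true → hi u ≡ true → ⊥) where

  private
    mid : Fin n → Bool
    mid u = not (lo u) ∧ not (hi u)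

    midˡ midʳ : Fin n × Fin n → Bool
    midˡ (u , v) = R u v ∧ mid u
    midʳ (u , v) = R u v ∧ mid v

  Rlo Rhi R′ : Fin n → Fin n → Bool
  Rlo u v = R u v ∧ lo u ∧ lo v
  Rhi u v = R u v ∧ hi u ∧ hi v
  R′ u v = R u v ∧ (lo u ∧ hi v ∨ hi u ∧ lo v)

  private
    classify : ∀ r l h l′ h′ → r ≡ true → (r ∧ l ∧ l′ ≡ true) ⊎ (r ∧ h ∧ h′ ≡ true) ⊎
      (r ∧ (l ∧ h′ ∨ h ∧ l′) ≡ true) ⊎ (r ∧ (not l ∧ not h) ≡ true) ⊎ (r ∧ (not l′ ∧ not h′) ≡ true)
    classify true true _ true _ _ = inj₁ refl
    classify true _ true _ true _ = inj₂ (inj₁ refl)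
    classify true true _ _ true _ = inj₂ (inj₂ (inj₁ refl))
    classify true false true true _ _ = inj₂ (inj₂ (inj₁ refl))
    classify true false false _ _ _ = inj₂ (inj₂ (inj₂ (inj₁ refl)))
    classify true true false false false _ = inj₂ (inj₂ (inj₂ (inj₂ refl)))
    classify true true true false false _ = inj₂ (inj₂ (inj₂ (inj₂ refl)))
    classify true false true false false _ = inj₂ (inj₂ (inj₂ (inj₂ refl)))

    ∨-true : ∀ {a b} → a ∨ b ≡ true → a ≡ true ⊎ b ≡ true
    ∨-true {true} _ = inj₁ refl
    ∨-true {false} e = inj₂ e

    not-true : ∀ {a} → not a ≡ true → a ≡ false
    not-true {false} _ = refl

    ¬lo : ∀ v → hi v ≡ true → lo v ≡ false
    ¬lo v h = Bool.¬-not λ l → lo∧hi v l h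

  Rlo-sym : ∀ u v → Rlo u v ≡ Rlo v u
  Rlo-sym u v = cong₂ _∧_ (R-sym u v) (Bool.∧-comm (lo u) (lo v))

  Rhi-sym : ∀ u v → Rhi u v ≡ Rhi v u
  Rhi-sym u v = cong₂ _∧_ (R-sym u v) (Bool.∧-comm (hi u) (hi v))

  R′-sym : ∀ u v → R′ u v ≡ R′ v u
  R′-sym u v = cong₂ _∧_ (R-sym u v) (trans (Bool.∨-comm (lo u ∧ hi v) (hi u ∧ lo v))
    (cong₂ _∨_ (Bool.∧-comm (hi u) (lo v)) (Bool.∧-comm (lo u) (hi v))))

  Rlo⁻ : ∀ u v → Rlo u v ≡ true → R u v ≡ true × lo u ≡ true × lo v ≡ true
  Rlo⁻ u v r = let r₁ , r₂ = ∧-true {R u v} r in r₁ , ∧-true {lo u} r₂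

  Rhi⁻ : ∀ u v → Rhi u v ≡ true → R u v ≡ true × hi u ≡ true × hi v ≡ true
  Rhi⁻ u v r = let r₁ , r₂ = ∧-true {R u v} r in r₁ , ∧-true {hi u} r₂

  R′⁻ : ∀ u v → R′ u v ≡ true → R u v ≡ true ×
    (lo u ≡ true × lo v ≡ false × hi v ≡ true ⊎ lo v ≡ true × lo u ≡ false × hi u ≡ true)
  R′⁻ u v r with ∧-true {R u v} r
  ... | r₁ , r₂ with ∨-true {lo u ∧ hi v} r₂
  ...   | inj₁ p = let l , h = ∧-true {lo u} p in r₁ , inj₁ (l , ¬lo v h , h)
  ...   | inj₂ p = let h , l = ∧-true {hi u} p in r₁ , inj₂ (l , ¬lo u h , h)

  -- Uniqueness of the middle vertex is assumed only among the neighbours of each vertex, because in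
  -- the recursion every class has a middle vertex of its own. Edges whose second end is in the
  -- middle then number at most n, and so do those whose first end is.
  edges-split : (∀ u v w → R u v ≡ true → R u w ≡ true →
      lo v ≡ false → hi v ≡ false → lo w ≡ false → hi w ≡ false → v ≡ w) →
    edges R ≤ edges Rlo + (edges Rhi + (edges R′ + (n + n)))
  edges-split mid-unique =
    ≤-trans (count-⊎ {P = half R} {Q = half Rlo} {R = λ p → half Rhi p ∨ (half R′ p ∨ (midˡ p ∨ midʳ p))} split (pairs n))
      (ℕ.+-monoʳ-≤ (edges Rlo)
    (≤-trans (count-⊎ {Q = half Rhi} {R = λ p → half R′ p ∨ (midˡ p ∨ midʳ p)} (λ p → ∨-true {half Rhi p}) (pairs n))
      (ℕ.+-monoʳ-≤ (edges Rhi)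
    (≤-trans (count-⊎ {Q = half R′} {R = λ p → midˡ p ∨ midʳ p} (λ p → ∨-true {half R′ p}) (pairs n))
      (ℕ.+-monoʳ-≤ (edges R′)
    (≤-trans (count-⊎ {Q = midˡ} {R = midʳ} (λ p → ∨-true {midˡ p}) (pairs n))
      (ℕ.+-mono-≤ midˡ≤ midʳ≤)))))))
    where
    mid⁻ : ∀ {u} → mid u ≡ true → lo u ≡ false × hi u ≡ false
    mid⁻ {u} m = let a , b = ∧-true {not (lo u)} m in not-true a , not-true b
    unique : ∀ u v w → R u v ≡ true → R u w ≡ true → mid v ≡ true → mid w ≡ true → v ≡ w
    unique u v w r r′ m m′ = let a , b = mid⁻ m ; a′ , b′ = mid⁻ m′ in mid-unique u v w r r′ a b a′ b′
    midʳ≤ : count midʳ (pairs n) ≤ n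
    midʳ≤ = count-functionalˡ midʳ λ u v w p p′ → let r , m = ∧-true {R u v} p ; r′ , m′ = ∧-true {R u w} p′ in
      unique u v w r r′ m m′
    midˡ≤ : count midˡ (pairs n) ≤ n
    midˡ≤ = count-functionalʳ midˡ λ u v w p p′ → let r , m = ∧-true {R u w} p ; r′ , m′ = ∧-true {R v w} p′ in
      unique w u v (trans (R-sym w u) r) (trans (R-sym w v) r′) m m′
    ∨-introˡ : ∀ {a b} → a ≡ true → a ∨ b ≡ true
    ∨-introˡ refl = refl
    ∨-introʳ : ∀ a {b} → b ≡ true → a ∨ b ≡ true
    ∨-introʳ true _ = refl
    ∨-introʳ false e = e
    split : ∀ p → half R p ≡ true → half Rlo p ≡ true ⊎ half Rhi p ∨ (half R′ p ∨ (midˡ p ∨ midʳ p)) ≡ true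
    split (u , v) h with ∧-true {toℕ u <ᵇ toℕ v} h
    ... | u<v , r with classify (R u v) (lo u) (hi u) (lo v) (hi v) r
    ...   | inj₁ p = inj₁ (∧-intro u<v p)
    ...   | inj₂ (inj₁ p) = inj₂ (∨-introˡ (∧-intro u<v p))
    ...   | inj₂ (inj₂ (inj₁ p)) = inj₂ (∨-introʳ (half Rhi (u , v)) (∨-introˡ (∧-intro u<v p)))
    ...   | inj₂ (inj₂ (inj₂ (inj₁ p))) = inj₂ (∨-introʳ (half Rhi (u , v)) (∨-introʳ (half R′ (u , v)) (∨-introˡ p)))
    ...   | inj₂ (inj₂ (inj₂ (inj₂ p))) = inj₂ (∨-introʳ (half Rhi (u , v)) (∨-introʳ (half R′ (u , v)) (∨-introʳ (midˡ (u , v)) p)))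

module _ {A : Set} (f : A → ℚ) (P : A → Bool) (P-< : ∀ a b → P a ≡ true → P b ≡ false → f a ℚ.< f b) where

  private
    lower : (ys : List A) → ∃[ l ] (∀ {b} → b ∈ ys → l ℚ.< f b)
    lower [] = 0ℚ , λ ()
    lower (b ∷ ys) with lower ys
    ... | l , l< = (f b ℚ.⊓ l) ℚ.- 1ℚ , λ
      { (here refl) → ℚ.<-≤-trans (m-1<m _) (ℚ.p⊓q≤p (f b) l)
      ; (there b∈) → ℚ.<-trans (ℚ.<-≤-trans (m-1<m _) (ℚ.p⊓q≤q (f b) l)) (l< b∈) }
      where
      m-1<m : ∀ m → m ℚ.- 1ℚ ℚ.< m
      m-1<m m = subst (m ℚ.- 1ℚ ℚ.<_) (ℚ.+-identityʳ m) (ℚ.+-monoʳ-< m (ℚ.negative⁻¹ (ℚ.- 1ℚ)))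

    max-true : (ys xs : List A) →
      ∃[ l ] ((∀ {a} → a ∈ xs → P a ≡ true → f a ℚ.≤ l) × (∀ {b} → b ∈ ys → P b ≡ false → l ℚ.< f b))
    max-true ys [] = proj₁ (lower ys) , (λ ()) , λ b∈ _ → proj₂ (lower ys) b∈
    max-true ys (a ∷ xs) with max-true ys xs | P a in pa
    ... | l , ≤l , l< | false = l , (λ { (here refl) pa′ → contradiction (trans (sym pa) pa′) λ () ; (there a∈) → ≤l a∈ }) , l<
    ... | l , ≤l , l< | true = f a ℚ.⊔ l ,
      (λ { (here refl) _ → ℚ.p≤p⊔q (f a) l ; (there a∈) p → ℚ.≤-trans (≤l a∈ p) (ℚ.p≤q⊔p (f a) l) }) ,
      λ b∈ pb → ⊔-< (P-< a _ pa pb) (l< b∈ pb)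
      where
      ⊔-< : ∀ {p q r} → p ℚ.< r → q ℚ.< r → p ℚ.⊔ q ℚ.< r
      ⊔-< {p} {q} p<r q<r with ℚ.≤-total p q
      ... | inj₁ p≤q = subst (ℚ._< _) (sym (ℚ.p≤q⇒p⊔q≡q p≤q)) q<r
      ... | inj₂ q≤p = subst (ℚ._< _) (sym (ℚ.p≥q⇒p⊔q≡p q≤p)) p<r

    min-false : ∀ l ys → (∀ {b} → b ∈ ys → P b ≡ false → l ℚ.< f b) →
      ∃[ r ] (l ℚ.< r × (∀ {b} → b ∈ ys → P b ≡ false → r ℚ.≤ f b))
    min-false l [] _ = l ℚ.+ 1ℚ , subst (ℚ._< l ℚ.+ 1ℚ) (ℚ.+-identityʳ l) (ℚ.+-monoʳ-< l 0<1) , λ ()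
    min-false l (b ∷ ys) l< with min-false l ys (λ b∈ → l< (there b∈)) | P b in pb
    ... | r , l<r , r≤ | true = r , l<r , λ { (here refl) pb′ → contradiction (trans (sym pb) pb′) λ () ; (there b∈) → r≤ b∈ }
    ... | r , l<r , r≤ | false = f b ℚ.⊓ r , <-⊓ (l< (here refl) pb) l<r ,
      λ { (here refl) _ → ℚ.p⊓q≤p (f b) r ; (there b∈) p → ℚ.≤-trans (ℚ.p⊓q≤q (f b) r) (r≤ b∈ p) }
      where
      <-⊓ : ∀ {p q r} → r ℚ.< p → r ℚ.< q → r ℚ.< p ℚ.⊓ q
      <-⊓ {p} {q} r<p r<q with ℚ.≤-total p q
      ... | inj₁ p≤q = subst (_ ℚ.<_) (sym (ℚ.p≤q⇒p⊓q≡p p≤q)) r<p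
      ... | inj₂ q≤p = subst (_ ℚ.<_) (sym (ℚ.p≥q⇒p⊓q≡q q≤p)) r<q

  -- In a finite set there is a gap between the largest value inside `P` and the smallest outside,
  -- and ℚ is dense. `lower` and `l + 1` supply the bounds when one side is empty.
  separate : (xs : List A) → (∀ a → a ∈ xs) → ∃[ θ ] ((∀ a → P a ≡ true → f a ℚ.< θ) × (∀ b → P b ≡ false → θ ℚ.< f b))
  separate xs full with max-true xs xs
  ... | l , ≤l , l< with min-false l xs l<
  ...   | r , l<r , r≤ with ℚ.<-dense l<r
  ...     | θ , l<θ , θ<r = θ , (λ a p → ℚ.≤-<-trans (≤l (full a) p) l<θ) , λ b p → ℚ.<-≤-trans θ<r (r≤ (full b) p)

-- Slopes of vertex pairs and the directions between them.

module Slopes (G : GeomGraph) (coords : Coordinates)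
  (x-inj : ∀ u v → abscissa coords G u ≡ abscissa coords G v → u ≡ v) where

  open Coordinates coords
  open +-*-Solver

  private
    n = size G
    x y : Fin n → ℚ
    x = abscissa coords G
    y u = η (pos G u)

  slope : Fin n × Fin n → ℚ
  slope (u , v) = (y v ℚ.- y u) ℚ.* inv (x v ℚ.- x u)

  slope-* : ∀ {u v} → x u ℚ.< x v → slope (u , v) ℚ.* (x v ℚ.- x u) ≡ y v ℚ.- y u
  slope-* {u} {v} u<v = trans
    (solve 3 (λ d i h → d :* i :* h := d :* (h :* i)) refl (y v ℚ.- y u) (inv (x v ℚ.- x u)) (x v ℚ.- x u))
    (trans (cong ((y v ℚ.- y u) ℚ.*_) (*-inv λ e → ℚ.<⇒≢ (0<q-p u<v) (sym e))) (ℚ.*-identityʳ _))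

  open Rank (pairs n) slope

  ρ : Fin n → Fin n → ℕ
  ρ u v = rank (slope (u , v))

  ρ<length : ∀ u v → ρ u v < length (pairs n)
  ρ<length u v = rank<length {u , v} (∈-pairs (u , v))

  -- This functional is constant along lines of slope θ, which makes a cut in that direction an
  -- instance of `Cut`.
  height : ℚ → Point → ℚ
  height θ p = η p ℚ.+ (ℚ.- θ) ℚ.* ξ p

  height-affine : ∀ θ → IsAffine (height θ)
  height-affine θ = +-affine η-affine (*-affine (ℚ.- θ) ξ-affine)

  height-diff : ∀ θ {u v} → x u ℚ.< x v →
    (slope (u , v) ℚ.- θ) ℚ.* (x v ℚ.- x u) ≡ height θ (pos G v) ℚ.- height θ (pos G u)
  height-diff θ {u} {v} u<v = trans
    (solve 3 (λ s t h → (s :- t) :* h := s :* h :- t :* h) refl (slope (u , v)) θ (x v ℚ.- x u))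
    (trans (cong (ℚ._- θ ℚ.* (x v ℚ.- x u)) (slope-* u<v))
      (solve 5 (λ yv yu t xv xu → yv :- yu :- t :* (xv :- xu) := yv :+ (:- t) :* xv :- (yu :+ (:- t) :* xu)) refl
        (y v) (y u) θ (x v) (x u)))

  steeper : ∀ {θ u v} → x u ℚ.< x v → θ ℚ.< slope (u , v) → height θ (pos G u) ℚ.< height θ (pos G v)
  steeper {θ} {u} {v} u<v θ<s = 0<q-p⇒p<q (subst (0ℚ ℚ.<_) (height-diff θ u<v) (*-pos (0<q-p θ<s) (0<q-p u<v)))

  flatter : ∀ {θ u v} → x u ℚ.< x v → slope (u , v) ℚ.< θ → height θ (pos G v) ℚ.< height θ (pos G u)
  flatter {θ} {u} {v} u<v s<θ = 0<q-p⇒p<q (subst (0ℚ ℚ.<_)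
    (trans (solve 3 (λ s t h → (t :- s) :* h := :- ((s :- t) :* h)) refl (slope (u , v)) θ (x v ℚ.- x u))
      (trans (cong ℚ.-_ (height-diff θ u<v))
        (solve 2 (λ a b → :- (a :- b) := b :- a) refl (height θ (pos G v)) (height θ (pos G u)))))
    (*-pos (0<q-p s<θ) (0<q-p u<v)))

  -- A direction whose slope lies strictly between the slopes of rank below t and all others. No two
  -- vertices span a line of exactly this slope, hence `g-injective`; and the order of two vertices
  -- under `g` tells on which side of t their rank is.
  record Direction (t : ℕ) : Set where
    field
      g : Point → ℚ
      g-affine : IsAffine g
      g-injective : ∀ u v → g (pos G u) ≡ g (pos G v) → u ≡ v
      rising : ∀ {u v} → x u ℚ.< x v → g (pos G u) ℚ.< g (pos G v) → t ≤ ρ u v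
      falling : ∀ {u v} → x u ℚ.< x v → g (pos G v) ℚ.< g (pos G u) → ρ u v < t

  direction : ∀ t → Direction t
  direction t =
    let θ , flat , steep = separate slope P
          (λ a b pa pb → rank-cancel-< {a} {b} (<-≤-trans (P-true a pa) (P-false b pb))) (pairs n) ∈-pairs
    in build θ (λ u v lt → flat (u , v) (dec-true (rank (slope (u , v)) ℕ.<? t) lt))
               (λ u v le → steep (u , v) (dec-false (rank (slope (u , v)) ℕ.<? t) (ℕ.≤⇒≯ le)))
    where
    P : Fin n × Fin n → Bool
    P p = does (rank (slope p) ℕ.<? t)
    P-true : ∀ p → P p ≡ true → rank (slope p) < t
    P-true p e = does⇒ (rank (slope p) ℕ.<? t) e
    P-false : ∀ p → P p ≡ false → t ≤ rank (slope p)
    P-false p e = ℕ.≮⇒≥ λ lt → contradiction (trans (sym (dec-true (rank (slope p) ℕ.<? t) lt)) e) λ ()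
    build : ∀ θ → (∀ u v → ρ u v < t → slope (u , v) ℚ.< θ) → (∀ u v → t ≤ ρ u v → θ ℚ.< slope (u , v)) → Direction t
    build θ flat steep = record
      { g = height θ
      ; g-affine = height-affine θ
      ; g-injective = inj
      ; rising = λ {u} {v} u<v gu<gv → ℕ.≮⇒≥ λ lt → ℚ.<-asym gu<gv (flatter {θ} {u} {v} u<v (flat u v lt))
      ; falling = λ {u} {v} u<v gv<gu → ℕ.≰⇒> λ le → ℚ.<-asym gv<gu (steeper {θ} {u} {v} u<v (steep u v le))
      }
      where
      distinct : ∀ u v → x u ℚ.< x v → height θ (pos G u) ≢ height θ (pos G v)
      distinct u v u<v e with ρ u v ℕ.<? t
      ... | yes lt = ℚ.<⇒≢ (flatter {θ} {u} {v} u<v (flat u v lt)) (sym e)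
      ... | no ≮ = ℚ.<⇒≢ (steeper {θ} {u} {v} u<v (steep u v (ℕ.≮⇒≥ ≮))) e
      inj : ∀ u v → height θ (pos G u) ≡ height θ (pos G v) → u ≡ v
      inj u v e = trichotomy (ℚ.<-cmp (x u) (x v))
        where
        trichotomy : Tri (x u ℚ.< x v) (x u ≡ x v) (x v ℚ.< x u) → u ≡ v
        trichotomy (tri< u<v _ _) = ⊥-elim (distinct u v u<v e)
        trichotomy (tri≈ _ x≡ _) = x-inj u v x≡
        trichotomy (tri> _ _ v<u) = ⊥-elim (distinct v u v<u (sym e))

  ρ-injective : ∀ u v w z → ρ u v ≡ ρ w z → slope (u , v) ≡ slope (w , z)
  ρ-injective u v w z e = ℚ.≤-antisym
    (rank-cancel-≤ {w , z} {slope (u , v)} (∈-pairs (w , z)) (ℕ.≤-reflexive e))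
    (rank-cancel-≤ {u , v} {slope (w , z)} (∈-pairs (u , v)) (ℕ.≤-reflexive (sym e)))

  collinear : ∀ {u v w} → x u ℚ.< x v → x v ℚ.< x w → slope (u , v) ≡ slope (u , w) → OnOpenSeg (pos G v) (pos G u) (pos G w)
  collinear {u} {v} {w} u<v v<w eq =
    let s , 0<s , s<1 , xs = mix-solve-pos u<v v<w
    in s , 0<s , s<1 , ξη-injective _ _ (trans (on-lerp ξ-affine _ _ s) xs) (trans (on-lerp η-affine _ _ s) (on-line s xs))
    where
    on-line : ∀ s → mix (x u) (x w) s ≡ x v → mix (y u) (y w) s ≡ y v
    on-line s xs = begin
      mix (y u) (y w) s
        ≡⟨ solve 3 (λ a b s → (con 1ℚ :- s) :* a :+ s :* b := a :+ s :* (b :- a)) refl (y u) (y w) s ⟩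
      y u ℚ.+ s ℚ.* (y w ℚ.- y u)
        ≡⟨ cong (λ d → y u ℚ.+ s ℚ.* d) (slope-* (ℚ.<-trans u<v v<w)) ⟨
      y u ℚ.+ s ℚ.* (slope (u , w) ℚ.* (x w ℚ.- x u))
        ≡⟨ solve 5 (λ yu s m xw xu → yu :+ s :* (m :* (xw :- xu)) :=
             yu :+ m :* ((con 1ℚ :- s) :* xu :+ s :* xw :- xu)) refl (y u) s (slope (u , w)) (x w) (x u) ⟩
      y u ℚ.+ slope (u , w) ℚ.* (mix (x u) (x w) s ℚ.- x u)
        ≡⟨ cong₂ (λ m a → y u ℚ.+ m ℚ.* (a ℚ.- x u)) (sym eq) xs ⟩
      y u ℚ.+ slope (u , v) ℚ.* (x v ℚ.- x u)
        ≡⟨ cong (y u ℚ.+_) (slope-* u<v) ⟩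
      y u ℚ.+ (y v ℚ.- y u)
        ≡⟨ solve 2 (λ a b → a :+ (b :- a) := b) refl (y u) (y v) ⟩
      y v ∎
      where open ≡-Reasoning

  -- Otherwise the nearer of the two right ends would lie inside the other edge, which `no-pass`
  -- forbids.
  equal-slope : ∀ {u v w} → Edge G u v → Edge G u w → x u ℚ.< x v → x u ℚ.< x w → ρ u v ≡ ρ u w → v ≡ w
  equal-slope {u} {v} {w} e e′ u<v u<w ρ≡ with ℚ.<-cmp (x v) (x w)
  ... | tri≈ _ x≡ _ = x-inj v w x≡
  ... | tri< v<w _ _ = contradiction (collinear u<v v<w (ρ-injective u v u w ρ≡)) (no-pass G u w v e′)
  ... | tri> _ _ w<v = contradiction (collinear u<w w<v (ρ-injective u w u v (sym ρ≡))) (no-pass G u v w e)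

-- The recursion on ranges of slope ranks.

module Levels {F F₂ : GeomGraph} (copies : IsTwoDisjointCopies F F₂)
  (has-edge : ¬ (∀ i j → ¬ Edge F i j)) (G : GeomGraph) (coords : Coordinates)
  (x-inj : ∀ u v → abscissa coords G u ≡ abscissa coords G v → u ≡ v)
  (x≢0 : ∀ u → abscissa coords G u ≢ 0ℚ) {e : ℕ}
  (ex : ∀ H → size H ≡ size G + size G → LineStabbed H → ¬ Contains H F → edgeCount H ≤ e)
  (F₂-free : ¬ WeaklyContains F₂ G (Edge G)) where

  open Slopes G coords x-inj
  open Redraw F has-edge G coords x≢0 ex

  private
    n = size G
    x : Fin n → ℚ
    x = abscissa coords G

  InClass : ∀ {K} → (Fin n → Fin n → Bool) → (Fin n → Fin K) → Fin K → Fin n → Fin n → Set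
  InClass R c i u v = R u v ≡ true × c u ≡ i

  -- (2i + 1) 2ᵏ is the midpoint of [i 2ᵏ⁺¹, (i + 1) 2ᵏ⁺¹), the range of class i before the halving.
  middle : ∀ k {K} (i : Fin K) → Direction (suc (2 * toℕ i) * 2 ^ k)
  middle k i = direction (suc (2 * toℕ i) * 2 ^ k)

  ClassCut : ∀ k {K} → (Fin n → Fin n → Bool) → (Fin n → Fin K) → Fin K → Set
  ClassCut k R c i = Cut F G (InClass R c i) (Direction.g (middle k i))

  -- The edges R that are still to be counted, grouped into classes spanned by disjoint vertex sets;
  -- the slopes in class i have a rank in [i 2ᵏ , (i + 1) 2ᵏ).
  record State (k K : ℕ) (c : Fin n → Fin K) (R : Fin n → Fin n → Bool) : Set where
    field
      R-sym : ∀ u v → R u v ≡ R v u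
      R⊆G : ∀ u v → R u v ≡ true → Edge G u v
      R-class : ∀ u v → R u v ≡ true → c u ≡ c v
      R-opposite : ∀ u v → R u v ≡ true → Opposite u v
      R-slope : ∀ u v → R u v ≡ true → x u ℚ.< x v → toℕ (c u) * 2 ^ k ≤ ρ u v × ρ u v < suc (toℕ (c u)) * 2 ^ k

  module Leaf {K} {c : Fin n → Fin K} {R : Fin n → Fin n → Bool} (st : State 0 K c R) where
    open State st

    left : Fin n → Bool
    left u = does (x u ℚ.<? 0ℚ)

    outgoing incoming : Fin n × Fin n → Bool
    outgoing (u , v) = R u v ∧ left u
    incoming (u , v) = R u v ∧ left v

    crossing-axis : ∀ {u v} → R u v ≡ true → x u ℚ.< 0ℚ → x u ℚ.< x v
    crossing-axis {u} {v} r u<0 with R-opposite u v r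
    ... | inj₁ (_ , 0<v) = ℚ.<-trans u<0 0<v
    ... | inj₂ (_ , 0<u) = contradiction u<0 (ℚ.<-asym 0<u)

    rank≡class : ∀ {u v} → R u v ≡ true → x u ℚ.< x v → ρ u v ≡ toℕ (c u)
    rank≡class {u} {v} r u<v with R-slope u v r u<v
    ... | lb , ub = ℕ.≤-antisym (ℕ.≤-pred (subst (ρ u v <_) (ℕ.*-identityʳ _) ub)) (subst (_≤ ρ u v) (ℕ.*-identityʳ _) lb)

    unique : ∀ {u v w} → R u v ≡ true → R u w ≡ true → left u ≡ true → v ≡ w
    unique {u} {v} {w} r r′ l = equal-slope (R⊆G u v r) (R⊆G u w r′) u<v u<w (trans (rank≡class r u<v) (sym (rank≡class r′ u<w)))
      where
      u<0 = does⇒ (x u ℚ.<? 0ℚ) l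
      u<v = crossing-axis r u<0
      u<w = crossing-axis r′ u<0

    -- A range of length 1 holds a single slope, so by `equal-slope` a vertex left of the axis has
    -- at most one edge. The left end of an edge may be either member of the pair, which accounts
    -- for n twice.
    leaf-bound : edges R ≤ n + n
    leaf-bound = ≤-trans (count-⊎ split (pairs n)) (ℕ.+-mono-≤
      (count-functionalˡ outgoing λ u v w o o′ → unique (proj₁ (∧-true o)) (proj₁ (∧-true o′)) (proj₂ (∧-true o)))
      (count-functionalʳ incoming λ u v w i i′ → unique (trans (R-sym w u) (proj₁ (∧-true i)))
        (trans (R-sym w v) (proj₁ (∧-true i′))) (proj₂ (∧-true {R u w} i))))
      where
      split : ∀ p → half R p ≡ true → outgoing p ≡ true ⊎ incoming p ≡ true
      split (u , v) h with R-opposite u v (proj₂ (∧-true h))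
      ... | inj₁ (u<0 , _) = inj₁ (∧-intro (proj₂ (∧-true h)) (dec-true (x u ℚ.<? 0ℚ) u<0))
      ... | inj₂ (v<0 , _) = inj₂ (∧-intro (proj₂ (∧-true h)) (dec-true (x v ℚ.<? 0ℚ) v<0))

  module Step {k K} {c : Fin n → Fin K} {R : Fin n → Fin n → Bool} (st : State (suc k) K c R)
    (cuts : ∀ i → ClassCut k R c i) where
    open State st

    lo hi : Fin n → Bool
    lo u = Cut.lo (cuts (c u)) u
    hi u = Cut.hi (cuts (c u)) u

    -- Each vertex is sorted by the cut of its own class; this transports between the cuts of two
    -- vertices whose classes are only provably equal.
    at-class : ∀ {A : Set} (f : ∀ {i} → ClassCut k R c i → A)
      {i j} → i ≡ j → f (cuts i) ≡ f (cuts j)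
    at-class f refl = refl

    open Split R R-sym lo hi (λ u → Cut.lo∧hi (cuts (c u)) u)

    -- Every class has an F-free low part, so `redraw` bounds the low edges of all classes by a
    -- single `e`.
    Rlo≤ : edges Rlo ≤ e
    Rlo≤ = redraw c Rlo Rlo-sym
      (λ u v r → R⊆G u v (proj₁ (Rlo⁻ u v r))) (λ u v r → R-class u v (proj₁ (Rlo⁻ u v r)))
      (λ u v r → R-opposite u v (proj₁ (Rlo⁻ u v r)))
      λ i ⊇F → Cut.lo-free (cuts i) (weaken F {G} {λ u v → Rlo u v ≡ true × c u ≡ i}
        {Within₂ (InClass R c i) (Cut.lo (cuts i))} (λ { u v (r , refl) → let r₁ , l , l′ = Rlo⁻ u v r in
        (r₁ , refl) , l , trans (at-class (λ ct → Cut.lo ct v) (R-class u v r₁)) l′ }) ⊇F)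

    Rhi≤ : edges Rhi ≤ e
    Rhi≤ = redraw c Rhi Rhi-sym
      (λ u v r → R⊆G u v (proj₁ (Rhi⁻ u v r))) (λ u v r → R-class u v (proj₁ (Rhi⁻ u v r)))
      (λ u v r → R-opposite u v (proj₁ (Rhi⁻ u v r)))
      λ i ⊇F → Cut.hi-free (cuts i) (weaken F {G} {λ u v → Rhi u v ≡ true × c u ≡ i}
        {Within₂ (InClass R c i) (Cut.hi (cuts i))} (λ { u v (r , refl) → let r₁ , h , h′ = Rhi⁻ u v r in
        (r₁ , refl) , h , trans (at-class (λ ct → Cut.hi ct v) (R-class u v r₁)) h′ }) ⊇F)

    step-bound : edges R ≤ e + (e + (edges R′ + (n + n)))
    step-bound = ≤-trans (edges-split mid-unique) (ℕ.+-mono-≤ Rlo≤ (ℕ.+-monoˡ-≤ (edges R′ + (n + n)) Rhi≤))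
      where
      mid-unique : ∀ u v w → R u v ≡ true → R u w ≡ true →
        lo v ≡ false → hi v ≡ false → lo w ≡ false → hi w ≡ false → v ≡ w
      -- Both neighbours lie in the class of `u`, whose cut leaves out at most one vertex.
      mid-unique u v w r r′ a b a′ b′ = Cut.middle (cuts (c v)) v w a b
        (trans (at-class (λ ct → Cut.lo ct w) cv≡cw) a′) (trans (at-class (λ ct → Cut.hi ct w) cv≡cw) b′)
        where cv≡cw = trans (sym (R-class u v r)) (R-class u w r′)

    left : Fin n → Bool
    left u = does (x u ℚ.<? 0ℚ)

    -- An edge crossing the cut of its class rises in the cut's direction iff its left end is low.
    bit : Bool → Bool → Fin 2
    bit true true = suc zero
    bit true false = zero
    bit false true = zero
    bit false false = suc zero

    -- An edge of `R′` changes both the side of the axis and the side of the cut. `bit` only records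
    -- whether the two agree, so it is the same at both ends, and the two halves of a class live on
    -- disjoint vertex sets.
    c′ : Fin n → Fin (K * 2)
    c′ u = combine (c u) (bit (left u) (lo u))

    opposite-left-end : ∀ {u v} → Opposite u v → x u ℚ.< x v → x u ℚ.< 0ℚ
    opposite-left-end (inj₁ (u<0 , _)) _ = u<0
    opposite-left-end {u} {v} (inj₂ (v<0 , 0<u)) u<v = ⊥-elim (ℚ.<-asym {x u} {x v} u<v (ℚ.<-trans v<0 0<u))

    opposite-left : ∀ {u v} → Opposite u v → left u ≡ not (left v)
    opposite-left {u} {v} (inj₁ (u<0 , 0<v)) = trans (dec-true (x u ℚ.<? 0ℚ) u<0)
      (cong not (sym (dec-false (x v ℚ.<? 0ℚ) (ℚ.<-asym 0<v))))
    opposite-left {u} {v} (inj₂ (v<0 , 0<u)) = trans (dec-false (x u ℚ.<? 0ℚ) (ℚ.<-asym 0<u))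
      (cong not (sym (dec-true (x v ℚ.<? 0ℚ) v<0)))

    same-bit : ∀ {a b l m} → a ≡ not b → l ≡ not m → bit a l ≡ bit b m
    same-bit {b = true} {m = true} refl refl = refl
    same-bit {b = true} {m = false} refl refl = refl
    same-bit {b = false} {m = true} refl refl = refl
    same-bit {b = false} {m = false} refl refl = refl

    lower : ∀ i k → i * 2 ^ suc k ≡ 2 * i * 2 ^ k
    lower i k = solve 2 (λ i p → i :* (con 2 :* p) := con 2 :* i :* p) refl i (2 ^ k)
      where open ℕS.+-*-Solver

    upper : ∀ i k → suc i * 2 ^ suc k ≡ suc (2 * i + 1) * 2 ^ k
    upper i k = solve 2 (λ i p → (con 1 :+ i) :* (con 2 :* p) := (con 1 :+ (con 2 :* i :+ con 1)) :* p) refl i (2 ^ k)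
      where open ℕS.+-*-Solver

    next : State k (K * 2) c′ R′
    next = record
      { R-sym = R′-sym
      ; R⊆G = λ u v r → R⊆G u v (proj₁ (R′⁻ u v r))
      ; R-class = λ u v r → let r₁ , sides = R′⁻ u v r in
          cong₂ combine (R-class u v r₁) (same-bit (opposite-left (R-opposite u v r₁)) (not-lo u v sides))
      ; R-opposite = λ u v r → R-opposite u v (proj₁ (R′⁻ u v r))
      ; R-slope = λ u v r u<v → let r₁ , sides = R′⁻ u v r in slopes u v r₁ sides u<v
      }
      where
      Sides : Fin n → Fin n → Set
      Sides u v = lo u ≡ true × lo v ≡ false × hi v ≡ true ⊎ lo v ≡ true × lo u ≡ false × hi u ≡ true
      not-lo : ∀ u v → Sides u v → lo u ≡ not (lo v)
      not-lo u v (inj₁ (a , b , _)) = trans a (cong not (sym b))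
      not-lo u v (inj₂ (b , a , _)) = trans a (cong not (sym b))
      slopes : ∀ u v → R u v ≡ true → Sides u v → x u ℚ.< x v →
        toℕ (c′ u) * 2 ^ k ≤ ρ u v × ρ u v < suc (toℕ (c′ u)) * 2 ^ k
      slopes u v r sides u<v = by-side sides
        where
        lb = proj₁ (R-slope u v r u<v)
        ub = proj₂ (R-slope u v r u<v)
        u<0 = opposite-left-end (R-opposite u v r) u<v
        lo-v : Cut.lo (cuts (c u)) v ≡ lo v
        lo-v = at-class (λ ct → Cut.lo ct v) (R-class u v r)
        c′≡ : ∀ {b} → lo u ≡ b → toℕ (c′ u) ≡ 2 * toℕ (c u) + toℕ (bit true b)
        c′≡ l = trans (toℕ-combine (c u) _)
          (cong (λ b → 2 * toℕ (c u) + toℕ b) (cong₂ bit (dec-true (x u ℚ.<? 0ℚ) u<0) l))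
        by-side : Sides u v → toℕ (c′ u) * 2 ^ k ≤ ρ u v × ρ u v < suc (toℕ (c′ u)) * 2 ^ k
        -- The left end is low: the edge rises across the cut, its rank is in the upper half, and
        -- the new index is 2i + 1. In the other case it falls and gets index 2i.
        by-side (inj₁ (l , l′ , _)) = subst (λ i → i * 2 ^ k ≤ ρ u v × ρ u v < suc i * 2 ^ k) (sym (c′≡ l))
          (subst (λ z → z * 2 ^ k ≤ ρ u v) (ℕ.+-comm 1 (2 * toℕ (c u)))
             (Direction.rising (middle k (c u)) u<v (Cut.lo-< (cuts (c u)) u v l (trans lo-v l′))) ,
           subst (ρ u v <_) (upper (toℕ (c u)) k) ub)
        by-side (inj₂ (l′ , l , _)) = subst (λ i → i * 2 ^ k ≤ ρ u v × ρ u v < suc i * 2 ^ k)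
          (sym (trans (c′≡ l) (ℕ.+-identityʳ _)))
          (subst (_≤ ρ u v) (lower (toℕ (c u)) k) lb ,
           Direction.falling (middle k (c u)) u<v (Cut.lo-< (cuts (c u)) v u (trans lo-v l′) l))

  -- A level pays `e` for the low edges, `e` for the high ones and n + n for those at middle
  -- vertices. The cuts of the finitely many classes exist only up to double negation and are
  -- gathered by `¬¬-choice`.
  levels : ∀ k {K} {c : Fin n → Fin K} {R : Fin n → Fin n → Bool} → State k K c R →
    edges R ≤ k * (e + e + (n + n)) + (n + n)
  levels zero st = Leaf.leaf-bound st
  levels (suc k) {K} {c} {R} st = ¬¬-≤ λ absurd → ¬¬-choice (λ i → class-cut i) λ cuts → absurd (bound cuts)
    where
    open State st
    class-cut : ∀ i → ¬ ¬ ClassCut k R c i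
    class-cut i = cut {F} {F₂} copies has-edge G {InClass R c i}
      (λ ⊇F₂ → F₂-free (weaken F₂ {G} {InClass R c i} {Edge G} (λ u v r → R⊆G u v (proj₁ r)) ⊇F₂))
      (Direction.g-affine (middle k i)) (Direction.g-injective (middle k i))
    bound : (∀ i → ClassCut k R c i) →
      edges R ≤ suc k * (e + e + (n + n)) + (n + n)
    bound cuts = ≤-trans (Step.step-bound st cuts) (≤-trans
      (ℕ.+-monoʳ-≤ e (ℕ.+-monoʳ-≤ e (ℕ.+-monoˡ-≤ (n + n) (levels k (Step.next st cuts)))))
      (ℕ.≤-reflexive (let open ℕS.+-*-Solver in solve 3 (λ e l n → e :+ (e :+ (l :+ (n :+ n) :+ (n :+ n))) :=
         (e :+ e :+ (n :+ n) :+ l) :+ (n :+ n)) refl e (k * (e + e + (n + n))) n)))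

-- The first cut, and the start of the recursion.

shear : ℚ → Point → ℚ
shear ε p = proj₁ p ℚ.+ ε ℚ.* proj₂ p

shear-affine : ∀ ε → IsAffine (shear ε)
shear-affine ε = +-affine proj₁-affine (*-affine ε proj₂-affine)

-- Points of different heights get the same image only if ε equals (xᵢ - xⱼ) / (yⱼ - yᵢ); an ε above
-- all these ratios avoids that. Points of equal height differ in x anyway.
shear-injective : ∀ {n} (P : Fin n → Point) → (∀ i j → P i ≡ P j → i ≡ j) →
  ∃[ ε ] (∀ i j → shear ε (P i) ≡ shear ε (P j) → i ≡ j)
shear-injective {n} P P-inj = ε , inj
  where
  open +-*-Solver
  X Y : Fin n → ℚ
  X i = proj₁ (P i)
  Y i = proj₂ (P i)
  ratio : Fin n → Fin n → ℚ
  ratio i j = (X i ℚ.- X j) ℚ.* inv (Y j ℚ.- Y i)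
  row = λ i → bounded (ratio i)
  all = bounded (λ i → proj₁ (row i))
  ε = proj₁ all
  ratio<ε : ∀ i j → ratio i j ℚ.< ε
  ratio<ε i j = ℚ.<-trans (proj₂ (row i) j) (proj₂ all i)
  ΔX : ∀ i j → shear ε (P i) ≡ shear ε (P j) → X i ℚ.- X j ≡ ε ℚ.* (Y j ℚ.- Y i)
  ΔX i j eq = begin
    X i ℚ.- X j                            ≡⟨ solve 4 (λ a b e y → a :- b := (a :+ e :* y) :- b :- e :* y) refl (X i) (X j) ε (Y i) ⟩
    shear ε (P i) ℚ.- X j ℚ.- ε ℚ.* Y i    ≡⟨ cong (λ z → z ℚ.- X j ℚ.- ε ℚ.* Y i) eq ⟩
    shear ε (P j) ℚ.- X j ℚ.- ε ℚ.* Y i    ≡⟨ solve 4 (λ b e z y → (b :+ e :* z) :- b :- e :* y := e :* (z :- y)) refl (X j) ε (Y j) (Y i) ⟩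
    ε ℚ.* (Y j ℚ.- Y i)                    ∎
    where open ≡-Reasoning
  inj : ∀ i j → shear ε (P i) ≡ shear ε (P j) → i ≡ j
  inj i j eq with (Y j ℚ.- Y i) ℚ.≟ 0ℚ
  ... | yes ΔY≡0 = P-inj i j (cong₂ _,_ (p-q≡0⇒p≡q (trans (ΔX i j eq) (trans (cong (ε ℚ.*_) ΔY≡0) (ℚ.*-zeroʳ ε))))
                     (sym (p-q≡0⇒p≡q ΔY≡0)))
  ... | no ΔY≢0 = contradiction ratio≡ε (ℚ.<⇒≢ (ratio<ε i j))
    where
    ratio≡ε : ratio i j ≡ ε
    ratio≡ε = trans (cong (ℚ._* inv (Y j ℚ.- Y i)) (ΔX i j eq))
      (trans (ℚ.*-assoc ε (Y j ℚ.- Y i) (inv (Y j ℚ.- Y i))) (trans (cong (ε ℚ.*_) (*-inv ΔY≢0)) (ℚ.*-identityʳ ε)))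

shifted : ℚ → ℚ → Coordinates
shifted ε x₀ = record
  { ξ = λ p → shear ε p ℚ.+ ℚ.- x₀
  ; η = proj₂
  ; ξ-affine = +-affine (shear-affine ε) (const-affine (ℚ.- x₀))
  ; η-affine = proj₂-affine
  ; ξη-injective = λ p q ξ≡ η≡ → cong₂ _,_ (begin
      proj₁ p                                                        ≡⟨ undo (proj₁ p) (proj₂ p) ⟩
      shear ε p ℚ.+ ℚ.- x₀ ℚ.+ x₀ ℚ.- ε ℚ.* proj₂ p ≡⟨ cong₂ (λ a b → a ℚ.+ x₀ ℚ.- ε ℚ.* b) ξ≡ η≡ ⟩
      shear ε q ℚ.+ ℚ.- x₀ ℚ.+ x₀ ℚ.- ε ℚ.* proj₂ q ≡⟨ undo (proj₁ q) (proj₂ q) ⟨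
      proj₁ q                                                        ∎) η≡
  }
  where
  open ≡-Reasoning
  open +-*-Solver
  undo : ∀ a b → a ≡ a ℚ.+ ε ℚ.* b ℚ.+ ℚ.- x₀ ℚ.+ x₀ ℚ.- ε ℚ.* b
  undo a b = solve 4 (λ a b e x → a := a :+ e :* b :+ :- x :+ x :- e :* b) refl a b ε x₀

subgraph : (G : GeomGraph) (R : Fin (size G) → Fin (size G) → Bool) → (∀ u v → R u v ≡ R v u) →
  (∀ u v → R u v ≡ true → Edge G u v) → GeomGraph
subgraph G R R-sym R⊆G = record
  { size = size G
  ; pos = pos G
  ; pos-inj = pos-inj G
  ; adj = R
  ; adj-sym = R-sym
  ; adj-irrefl = irrefl
  ; no-pass = λ i j v r → no-pass G i j v (R⊆G i j r)
  }
  where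
  irrefl : ∀ u → R u u ≡ false
  irrefl u with R u u in eq
  ... | false = refl
  ... | true = trans (sym (R⊆G u u eq)) (adj-irrefl G u)

length-pairs : ∀ n → length (pairs n) ≡ n * n
length-pairs n = trans (length-product (allFin n) (allFin n))
  (cong₂ _*_ (length-tabulate {n = n} λ i → i) (length-tabulate {n = n} λ i → i))
  where
  length-product : ∀ {A B : Set} (xs : List A) (ys : List B) → length (cartesianProduct xs ys) ≡ length xs * length ys
  length-product [] ys = refl
  length-product (x ∷ xs) ys = trans (length-++ (map (x ,_) ys)) (cong₂ _+_ (length-map (x ,_) ys) (length-product xs ys))

edges≤n² : ∀ {n} (R : Fin n → Fin n → Bool) → edges R ≤ n * n
edges≤n² {n} R = ≤-trans (length-filter (λ p → T? (half R p)) (pairs n)) (ℕ.≤-reflexive (length-pairs n))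

module Bound {F F₂ : GeomGraph} (copies : IsTwoDisjointCopies F F₂)
  (has-edge : ¬ (∀ i j → ¬ Edge F i j)) (G : GeomGraph) {eL eF : ℕ}
  (exL : ∀ H → size H ≡ size G + size G → LineStabbed H → ¬ Contains H F → edgeCount H ≤ eL)
  (exF : ∀ H → size H ≡ size G → ¬ Contains H F → edgeCount H ≤ eF)
  (F₂-free : ¬ WeaklyContains F₂ G (Edge G)) where

  private n = size G

  module _ (ε : ℚ) (ε-inj : ∀ u v → shear ε (pos G u) ≡ shear ε (pos G v) → u ≡ v)
    (ct : Cut F G (Edge G) (shear ε)) where
    open Cut ct
    open Split (adj G) (adj-sym G) lo hi lo∧hi

    Rlo≤ : edges Rlo ≤ eF
    Rlo≤ = exF (subgraph G Rlo Rlo-sym (λ u v r → proj₁ (Rlo⁻ u v r))) refl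
      λ { (φ , inj , edge , cross) → lo-free (φ , (λ i _ k _ _ _ → inj i k) , (λ i j e → Rlo⁻ _ _ (edge i j e)) , cross) }

    Rhi≤ : edges Rhi ≤ eF
    Rhi≤ = exF (subgraph G Rhi Rhi-sym (λ u v r → proj₁ (Rhi⁻ u v r))) refl
      λ { (φ , inj , edge , cross) → hi-free (φ , (λ i _ k _ _ _ → inj i k) , (λ i j e → Rhi⁻ _ _ (edge i j e)) , cross) }

    R′≤ : ∀ k → n * n ≤ 2 ^ k → edges R′ ≤ k * (eL + eL + (n + n)) + (n + n)
    -- The line is placed just beyond the low vertices. A middle vertex falls to its right, where no
    -- edge of `R′` meets it.
    R′≤ k n²≤2ᵏ = across (separate (λ u → shear ε (pos G u)) lo lo-< (allFin n) ∈-allFin)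
      where
      across : ∃[ x₀ ] ((∀ u → lo u ≡ true → shear ε (pos G u) ℚ.< x₀) × (∀ u → lo u ≡ false → x₀ ℚ.< shear ε (pos G u))) →
        edges R′ ≤ k * (eL + eL + (n + n)) + (n + n)
      across (x₀ , left , right) = levels k state
        where
        open Coordinates (shifted ε x₀)
        lo<0 : ∀ u → lo u ≡ true → ξ (pos G u) ℚ.< 0ℚ
        lo<0 u l = subst (ξ (pos G u) ℚ.<_) (ℚ.+-inverseʳ x₀) (ℚ.+-monoˡ-< (ℚ.- x₀) (left u l))
        0<hi : ∀ u → lo u ≡ false → 0ℚ ℚ.< ξ (pos G u)
        0<hi u l = 0<q-p (right u l)
        x≢0 : ∀ u → ξ (pos G u) ≢ 0ℚ
        x≢0 u e with lo u in eq
        ... | true = ℚ.<⇒≢ (lo<0 u eq) e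
        ... | false = ℚ.<⇒≢ (0<hi u eq) (sym e)
        x-inj : ∀ u v → ξ (pos G u) ≡ ξ (pos G v) → u ≡ v
        x-inj u v e = ε-inj u v (trans (sym (q-p+p x₀ (shear ε (pos G u)))) (trans (cong (ℚ._+ x₀) e) (q-p+p x₀ (shear ε (pos G v)))))
        open Levels {F} {F₂} copies has-edge G (shifted ε x₀) x-inj x≢0 exL F₂-free
        open Slopes G (shifted ε x₀) x-inj
        -- A single class at the start: its range [0, 2ᵏ) contains all n² ranks.
        state : State k 1 (λ _ → zero) R′
        state = record
          { R-sym = R′-sym
          ; R⊆G = λ u v r → proj₁ (R′⁻ u v r)
          ; R-class = λ _ _ _ → refl
          ; R-opposite = λ u v r → opposite u v (proj₂ (R′⁻ u v r))
          ; R-slope = λ u v _ _ → z≤n , <-≤-trans (ρ<length u v)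
              (≤-trans (ℕ.≤-reflexive (length-pairs n)) (≤-trans n²≤2ᵏ (ℕ.≤-reflexive (sym (ℕ.+-identityʳ (2 ^ k))))))
          }
          where
          opposite : ∀ u v → lo u ≡ true × lo v ≡ false × hi v ≡ true ⊎ lo v ≡ true × lo u ≡ false × hi u ≡ true →
            ξ (pos G u) ℚ.< 0ℚ × 0ℚ ℚ.< ξ (pos G v) ⊎ ξ (pos G v) ℚ.< 0ℚ × 0ℚ ℚ.< ξ (pos G u)
          opposite u v (inj₁ (l , l′ , _)) = inj₁ (lo<0 u l , 0<hi v l′)
          opposite u v (inj₂ (l , l′ , _)) = inj₂ (lo<0 v l , 0<hi u l′)

    cut-bound : ∀ k → n * n ≤ 2 ^ k → edges (adj G) ≤ eF + (eF + (k * (eL + eL + (n + n)) + (n + n) + (n + n)))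
    cut-bound k n²≤2ᵏ = ≤-trans (edges-split λ u v w _ _ → middle v w)
      (ℕ.+-mono-≤ Rlo≤ (ℕ.+-mono-≤ Rhi≤ (ℕ.+-monoˡ-≤ (n + n) (R′≤ k n²≤2ᵏ))))

  edge-bound : ∀ k → n * n ≤ 2 ^ k → edges (adj G) ≤ eF + (eF + (k * (eL + eL + (n + n)) + (n + n) + (n + n)))
  edge-bound k n²≤2ᵏ =
    let ε , ε-inj = shear-injective (pos G) (pos-inj G)
    in ¬¬-≤ λ absurd → cut {F} {F₂} copies has-edge G {Edge G} F₂-free (shear-affine ε) ε-inj
         λ ct → absurd (cut-bound ε ε-inj ct k n²≤2ᵏ)

-- Constants and conclusion.

n<2^[1+⌊log₂n⌋] : ∀ n → n < 2 ^ suc ⌊log₂ n ⌋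
n<2^[1+⌊log₂n⌋] n = ℕ.≰⇒> λ le → ℕ.1+n≰n (ℕ.≤-trans (ℕ.≤-reflexive (sym (⌊log₂[2^n]⌋≡n (suc ⌊log₂ n ⌋)))) (⌊log₂⌋-mono-≤ le))

n²≤2^ : ∀ n → n * n ≤ 2 ^ (suc ⌊log₂ n ⌋ + suc ⌊log₂ n ⌋)
n²≤2^ n = subst (n * n ≤_) (sym (ℕ.^-distribˡ-+-* 2 (suc ⌊log₂ n ⌋) (suc ⌊log₂ n ⌋)))
  (ℕ.*-mono-≤ (ℕ.<⇒≤ (n<2^[1+⌊log₂n⌋] n)) (ℕ.<⇒≤ (n<2^[1+⌊log₂n⌋] n)))

1≤⌊log₂⌋ : ∀ {n} → 2 ≤ n → 1 ≤ ⌊log₂ n ⌋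
1≤⌊log₂⌋ = ⌊log₂⌋-mono-≤

-- For graphs too small to be sure of room for the isolated vertices of `F₂`, the trivial bound n² ≤
-- m n suffices. This is the summand m in the constant.
few-vertices : ∀ {n m l eL eF} → 1 ≤ l → n ≤ m → n * n ≤ (12 + m) * ((eL + n) * l + eF)
few-vertices {n} {m} {l} {eL} {eF} 1≤l n≤m = begin
  n * n                         ≤⟨ ℕ.*-mono-≤ (≤-trans n≤m (ℕ.m≤n+m m 12)) (begin
    n                           ≤⟨ ℕ.m≤n+m n eL ⟩
    eL + n                      ≡⟨ ℕ.*-identityʳ (eL + n) ⟨
    (eL + n) * 1                ≤⟨ ℕ.*-monoʳ-≤ (eL + n) 1≤l ⟩
    (eL + n) * l                ≤⟨ ℕ.m≤m+n _ eF ⟩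
    (eL + n) * l + eF           ∎) ⟩
  (12 + m) * ((eL + n) * l + eF) ∎
  where open ℕ.≤-Reasoning

-- Origin of 12: as l ≥ 1, the 2(l + 1) ≤ 4l levels of cost 2(eL + n) give at most 8 l (eL + n), and
-- the four remaining n are at most 4 l (eL + n). The two `eF` fit as well.
many-vertices : ∀ m n l eL eF → 1 ≤ l →
  eF + (eF + ((suc l + suc l) * (eL + eL + (n + n)) + (n + n) + (n + n))) ≤ (12 + m) * ((eL + n) * l + eF)
many-vertices m n (suc l) eL eF _ = ≤-trans (ℕ.m≤m+n _ (10 * eF + 8 * (l * (eL + n)) + 4 * eL))
  (≤-trans (ℕ.≤-reflexive (solve 4 (λ n l a b →
      b :+ (b :+ ((con 2 :+ l :+ (con 2 :+ l)) :* (a :+ a :+ (n :+ n)) :+ (n :+ n) :+ (n :+ n))) :+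
        (con 10 :* b :+ con 8 :* (l :* (a :+ n)) :+ con 4 :* a) :=
      con 12 :* ((a :+ n) :* (con 1 :+ l) :+ b)) refl n l eL eF))
    (ℕ.*-monoˡ-≤ ((eL + n) * suc l + eF) (ℕ.m≤m+n 12 m)))
  where open ℕS.+-*-Solver

theorem5 : (F F₂ : GeomGraph) → IsTwoDisjointCopies F F₂ →
    ∃[ C ] (∀ (n : ℕ) → 2 ≤ n → ∀ (exLF exF exF₂ : ℕ) →
    IsExL F (2 * n) exLF → IsEx F n exF → IsEx F₂ n exF₂ →
    exF₂ ≤ C * ((exLF + n) * ⌊log₂ n ⌋ + exF))
theorem5 F F₂ copies = 12 + (size F + size F) , bound
  where
  m = size F + size F
  bound : ∀ (n : ℕ) → 2 ≤ n → ∀ (exLF exF exF₂ : ℕ) →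
    IsExL F (2 * n) exLF → IsEx F n exF → IsEx F₂ n exF₂ →
    exF₂ ≤ (12 + m) * ((exLF + n) * ⌊log₂ n ⌋ + exF)
  bound n 2≤n eL eF e₂ ((H , refl-size , _ , H-free , _) , exL) (_ , exF) ((G , refl , G-free , refl) , _) with size G ℕ.≤? m
  ... | yes n≤m = ≤-trans (edges≤n² (adj G)) (few-vertices {eL = eL} {eF} (1≤⌊log₂⌋ 2≤n) n≤m)
  ... | no n≰m = ≤-trans (Bound.edge-bound {F} {F₂} copies has-edge G {eL} {eF}
      (λ K K-size → exL K (trans K-size (cong (size G +_) (sym (ℕ.+-identityʳ (size G))))))
      exF (λ ⊇F₂ → G-free (contains F₂ G F₂≤n ⊇F₂)) (suc l + suc l) (n²≤2^ (size G)))
      (many-vertices m (size G) l eL eF (1≤⌊log₂⌋ 2≤n))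
    where
    l = ⌊log₂ size G ⌋
    m≤n = ℕ.<⇒≤ (ℕ.≰⇒> n≰m)
    F₂≤n : size F₂ ≤ size G
    F₂≤n = ≤-trans (TwoCopies.copies-size {F} {F₂} copies) m≤n
    F≤H : size F ≤ size H
    F≤H = ≤-trans (ℕ.m≤m+n (size F) (size F)) (≤-trans m≤n (subst (size G ≤_) (sym refl-size) (ℕ.m≤m+n (size G) (size G + 0))))
    -- The extremal graph `H` on 2n vertices is F-free but large enough to contain an edgeless F.
    has-edge : ¬ (∀ i j → ¬ Edge F i j)
    has-edge none = H-free (contains F H F≤H (WeaklyContains-edgeless F H {Edge H} none (λ i → inject≤ i F≤H)))
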